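{- For every real $\varepsilon$ with $0<\varepsilon<1/6$ there exists $q_0$ such that for all integers $q\geq q_0$ and all integers $p\geq 1$ with $p\leq\left(1/6-\varepsilon\right)q$, \[ r\left(B_{p},B_{q}\right)=2q+3. \]
   Context: For an integer $m\ge 1$, the book $B_m$ is the graph consisting of $m$ triangles sharing a common edge (i.e. $K_2$ joined to $m$ independent vertices). The Ramsey number $r(B_p,B_q)$ is the least integer $N$ such that for every graph $G$ on $N$ vertices, either $G$ contains $B_p$ as a subgraph or the complement $\overline{G}$ contains $B_q$ as a subgraph. -}

module Defs where

open import Data.Nat using (ℕ; _<_)
open import Data.Fin using (Fin)
open import Data.Bool using (Bool; true; false)
open import Data.Product using (Σ; ∃; _×_; _,_)
open import Function.Definitions using (Injective)
open import Relation.Binary.PropositionalEquality using (_≡_)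
open import Relation.Nullary using (¬_)

record Graph (n : ℕ) : Set where
  field
    adj   : Fin n → Fin n → Bool
    sym   : ∀ x y → adj x y ≡ adj y x
    irrefl : ∀ x → adj x x ≡ false

open Graph public

Adj : ∀ {n} → Graph n → Fin n → Fin n → Set
Adj G x y = adj G x y ≡ true

CoAdj : ∀ {n} → Graph n → Fin n → Fin n → Set
CoAdj G x y = ¬ (x ≡ y) × adj G x y ≡ false

-- A graph with adjacency relation R (on Fin n) contains the book B_m
-- (K_2 joined to m independent vertices) as a subgraph: there is an edge uv
-- and m distinct vertices, each different from u and v, adjacent to both u and v.
ContainsBookIn : ∀ {n} → (Fin n → Fin n → Set) → ℕ → Set
ContainsBookIn {n} R m =
  Σ (Fin n) λ u → Σ (Fin n) λ v → Σ (Fin m → Fin n) λ f →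
    ¬ (u ≡ v) × R u v × Injective _≡_ _≡_ f ×
    (∀ i → ¬ (f i ≡ u) × ¬ (f i ≡ v) × R u (f i) × R v (f i))

RamseyProperty : ℕ → ℕ → ℕ → Set
RamseyProperty p q N =
  (G : Graph N) → ContainsBookIn (Adj G) p Data.Sum.⊎ ContainsBookIn (CoAdj G) q
  where import Data.Sum

BookRamseyEq : ℕ → ℕ → ℕ → Set
BookRamseyEq p q N = RamseyProperty p q N × (∀ M → M < N → ¬ RamseyProperty p q M)

{-# OPTIONS --safe #-}
module Submission where

-- Upper bound.  Let G have n = 2q + 3 vertices, let every edge lie in at most p < n/12 − εn triangles
-- and let any two non-adjacent vertices have at most q + 1 ≤ n/2 common non-neighbours (counting
-- themselves).  For a set U of m vertices let x(w) ∈ [0,1] be the fraction of U adjacent to w.  If U is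
-- independent, averaging over pairs in U gives ∫(1 − x)² ≤ 1/2 + O(1/m); if U and W are completely
-- joined, ∫xy ≤ p/n.  For three independent sets that are pairwise completely joined, integrating
-- (x + y + z − 1)² ≥ 0 contradicts p/n < 1/12 − ε, so for large m there are no three such sets.
--
-- A clique of bounded size has average degree at most n/√12 < 0.29n, so outside the set L of vertices of
-- degree below 0.29n Ramsey's theorem always yields independent sets U.  Pick joined independent sets
-- U, W outside L.  Since a third joined set is impossible, min(x, y) ≈ 0 at all but boundedly many
-- vertices outside L, so (1 − x)² + (1 − y)² ≥ 1 there, whereas the integral of the left side is at most
-- 1 + o(1).  Choosing U and W with as few neighbours in L as possible forces |L| = o(n), because L is
-- nearly a clique and the average density towards L is below 1 − 1/√2.  Hence x and y are almost
-- complementary indicator functions, and G contains an almost complete bipartite graph with parts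
-- A, B of size about n/2.
--
-- Finally A and B are independent; let R be the vertices with neighbours in both.  Each has at most
-- (p + n/50) ≤ |A|/4 neighbours in A, so two vertices of A have |R|/2 common non-neighbours in R and
-- every vertex without neighbours in A as a further one; with the same bound for B this gives
-- n ≤ 2(q + 1), a contradiction.
--
-- Lower bound.  The complete bipartite graph with parts of size at most q + 1.

open import Defs renaming (sym to adj-sym)

module BookRamsey where

  open import Data.Bool as Bool using (Bool; true; false; not; _∧_; _xor_; T; if_then_else_)
  open import Data.Bool.Properties using (T-∧; xor-comm; xor-same)
  open import Data.Empty using (⊥; ⊥-elim)
  open import Data.Fin using (Fin; zero; suc; toℕ; fromℕ<; _≟_)
  open import Data.Fin.Properties using (any?; toℕ-injective; toℕ<n; fromℕ<-injective; injective⇒≤)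
  open import Data.List using (List; []; _∷_; filterᵇ; length; allFin)
  open import Data.List.Membership.Propositional using (_∈_)
  open import Data.List.Properties using (≡-dec; length-tabulate)
  open import Data.List.Relation.Binary.Sublist.Propositional using (_⊆_; []; _∷ʳ_; _∷_; ⊆-refl; ⊆-trans; minimum)
  open import Data.List.Relation.Binary.Sublist.Propositional.Properties using (All-resp-⊆; Any-resp-⊆)
  open import Data.List.Relation.Unary.All as All using (All; []; _∷_)
  open import Data.List.Relation.Unary.AllPairs as AllPairs using (AllPairs; []; _∷_)
  open import Data.List.Relation.Unary.Any using (here; there)
  open import Data.List.Relation.Unary.Unique.Propositional.Properties using (allFin⁺)
  open import Data.Nat as Nat using (ℕ; zero; suc; _+_; _*_; _∸_; _^_; _≤_; _<_; z≤n; s≤s; s≤s⁻¹; _≤ᵇ_; _<ᵇ_; _≤?_; NonZero; >-nonZero)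
  open import Data.Nat.Properties hiding (_≟_)
  open import Data.Nat.Tactic.RingSolver using (solve-∀)
  open import Data.Product using (∃; Σ; _×_; _,_; proj₁; proj₂)
  open import Data.Sum using (_⊎_; inj₁; inj₂)
  open import Data.Vec using (Vec; []; _∷_; tabulate)
  open import Data.Vec.N-ary using (N-ary; _$ⁿ_)
  open import Function using (_∘_; id)
  open import Function.Bundles using (Equivalence)
  open import Function.Definitions using (Injective)
  open import Relation.Binary.PropositionalEquality using (_≡_; _≢_; refl; sym; trans; cong; cong₂; subst; subst₂)
  open import Relation.Nullary using (¬_; yes; no; ⌊_⌋; contradiction; _×-dec_; ¬?)

  -- Inequalities between polynomials over ℕ

  +-exchange : ∀ a b c → a + (b + c) ≡ b + (a + c)
  +-exchange = solve-∀

  *-exchange : ∀ a b c → a * (b * c) ≡ b * (a * c)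
  *-exchange = solve-∀

  +-interchange : ∀ a b c d → a + b + (c + d) ≡ a + c + (b + d)
  +-interchange = solve-∀

  infixl 6 _⊕_
  infixl 7 _⊗_ _·_
  infix 4 _⊑_
  infixr 2 _⟨_⟩⇒_

  data Expr : Set where
    var #   : ℕ → Expr
    _⊕_ _⊗_ : Expr → Expr → Expr

  _·_ : Expr → ℕ → Expr
  e · c = e ⊗ # c

  data Ineq : Set where
    _⊑_ : Expr → Expr → Ineq

  -- (aᵢ ⊑ bᵢ) ⟨ cᵢ ⟩⇒ … goal (l ⊑ r) derives l ≤ r from the aᵢ ≤ bᵢ; the multipliers cᵢ must make
  -- every coefficient of r − l − Σ cᵢ (bᵢ − aᵢ) nonnegative.
  data Problem : Set where
    goal    : Ineq → Problem
    _⟨_⟩⇒_ : Ineq → Expr → Problem → Problem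

  get : ∀ {n} → Vec ℕ n → ℕ → ℕ
  get []      _       = 0
  get (x ∷ ρ) zero    = x
  get (x ∷ ρ) (suc i) = get ρ i

  module _ {n : ℕ} (ρ : Vec ℕ n) where

    ⟦_⟧ : Expr → ℕ
    ⟦ var i ⟧ = get ρ i
    ⟦ # c ⟧   = c
    ⟦ a ⊕ b ⟧ = ⟦ a ⟧ + ⟦ b ⟧
    ⟦ a ⊗ b ⟧ = ⟦ a ⟧ * ⟦ b ⟧

    ⟦_⟧ᴵ : Ineq → Set
    ⟦ a ⊑ b ⟧ᴵ = ⟦ a ⟧ ≤ ⟦ b ⟧

    ⟦_⟧ᴾ : Problem → Set
    ⟦ goal i ⟧ᴾ       = ⟦ i ⟧ᴵ
    ⟦ i ⟨ _ ⟩⇒ P ⟧ᴾ = ⟦ i ⟧ᴵ → ⟦ P ⟧ᴾ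

  Mono : Set
  Mono = List ℕ

  Poly : Set
  Poly = List (Mono × ℕ)

  insert : ℕ → Mono → Mono
  insert i []       = i ∷ []
  insert i (j ∷ js) = if i ≤ᵇ j then i ∷ j ∷ js else j ∷ insert i js

  _·ᴹ_ : Mono → Mono → Mono
  []       ·ᴹ js = js
  (i ∷ is) ·ᴹ js = insert i (is ·ᴹ js)

  add : Mono → ℕ → Poly → Poly
  add μ c [] = (μ , c) ∷ []
  add μ c ((ν , d) ∷ P) with ≡-dec Nat._≟_ μ ν
  ... | yes _ = (ν , c + d) ∷ P
  ... | no  _ = (ν , d) ∷ add μ c P

  _+ᴾ_ : Poly → Poly → Poly
  []            +ᴾ Q = Q
  ((μ , c) ∷ P) +ᴾ Q = add μ c (P +ᴾ Q)

  scale : Mono → ℕ → Poly → Poly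
  scale μ c []            = []
  scale μ c ((ν , d) ∷ Q) = add (μ ·ᴹ ν) (c * d) (scale μ c Q)

  _*ᴾ_ : Poly → Poly → Poly
  []            *ᴾ Q = []
  ((μ , c) ∷ P) *ᴾ Q = scale μ c Q +ᴾ (P *ᴾ Q)

  poly : Expr → Poly
  poly (var i) = (i ∷ [] , 1) ∷ []
  poly (# c)   = ([] , c) ∷ []
  poly (a ⊕ b) = poly a +ᴾ poly b
  poly (a ⊗ b) = poly a *ᴾ poly b

  coeff : Mono → Poly → ℕ
  coeff μ [] = 0
  coeff μ ((ν , d) ∷ P) with ≡-dec Nat._≟_ μ ν
  ... | yes _ = d
  ... | no  _ = coeff μ P

  delete : Mono → Poly → Poly
  delete μ [] = []
  delete μ ((ν , d) ∷ P) with ≡-dec Nat._≟_ μ ν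
  ... | yes _ = P
  ... | no  _ = (ν , d) ∷ delete μ P

  -- A matched term is deleted on the right, so that a repeated monomial is never compared twice
  -- with the same term.
  _≤ᴾ_ : Poly → Poly → Bool
  []            ≤ᴾ Q = true
  ((μ , c) ∷ P) ≤ᴾ Q = (c ≤ᵇ coeff μ Q) ∧ (P ≤ᴾ delete μ Q)

  -- In place of subtraction, `l` collects the larger and `r` the smaller sides of the scaled
  -- hypotheses. Finally `a + l ≤ b + r` and `r ≤ l` give `a ≤ b`.
  check : Problem → Expr → Expr → Bool
  check (goal (a ⊑ b))       l r = poly (a ⊕ l) ≤ᴾ poly (b ⊕ r)
  check ((a ⊑ b) ⟨ c ⟩⇒ P) l r = check P (l ⊕ c ⊗ b) (r ⊕ c ⊗ a)

  module _ {n : ℕ} (ρ : Vec ℕ n) where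

    ⟦_⟧ᴹ : Mono → ℕ
    ⟦ [] ⟧ᴹ     = 1
    ⟦ i ∷ μ ⟧ᴹ = get ρ i * ⟦ μ ⟧ᴹ

    ⟦_⟧ᵖ : Poly → ℕ
    ⟦ [] ⟧ᵖ           = 0
    ⟦ (μ , c) ∷ P ⟧ᵖ = ⟦ μ ⟧ᴹ * c + ⟦ P ⟧ᵖ

    ⟦insert⟧ : ∀ i μ → ⟦ insert i μ ⟧ᴹ ≡ get ρ i * ⟦ μ ⟧ᴹ
    ⟦insert⟧ i []      = refl
    ⟦insert⟧ i (j ∷ μ) with i ≤ᵇ j
    ... | true  = refl
    ... | false = trans (cong (get ρ j *_) (⟦insert⟧ i μ)) (*-exchange (get ρ j) (get ρ i) ⟦ μ ⟧ᴹ)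

    ⟦·ᴹ⟧ : ∀ μ ν → ⟦ μ ·ᴹ ν ⟧ᴹ ≡ ⟦ μ ⟧ᴹ * ⟦ ν ⟧ᴹ
    ⟦·ᴹ⟧ []      ν = sym (+-identityʳ _)
    ⟦·ᴹ⟧ (i ∷ μ) ν = trans (⟦insert⟧ i (μ ·ᴹ ν))
      (trans (cong (get ρ i *_) (⟦·ᴹ⟧ μ ν)) (sym (*-assoc (get ρ i) ⟦ μ ⟧ᴹ ⟦ ν ⟧ᴹ)))

    ⟦add⟧ : ∀ μ c P → ⟦ add μ c P ⟧ᵖ ≡ ⟦ μ ⟧ᴹ * c + ⟦ P ⟧ᵖ
    ⟦add⟧ μ c [] = refl
    ⟦add⟧ μ c ((ν , d) ∷ P) with ≡-dec Nat._≟_ μ ν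
    ... | yes refl = eq ⟦ μ ⟧ᴹ c d ⟦ P ⟧ᵖ
      where
      eq : ∀ m c d p → m * (c + d) + p ≡ m * c + (m * d + p)
      eq = solve-∀
    ... | no  _ = trans (cong (⟦ ν ⟧ᴹ * d +_) (⟦add⟧ μ c P)) (+-exchange (⟦ ν ⟧ᴹ * d) (⟦ μ ⟧ᴹ * c) ⟦ P ⟧ᵖ)

    ⟦+ᴾ⟧ : ∀ P Q → ⟦ P +ᴾ Q ⟧ᵖ ≡ ⟦ P ⟧ᵖ + ⟦ Q ⟧ᵖ
    ⟦+ᴾ⟧ []            Q = refl
    ⟦+ᴾ⟧ ((μ , c) ∷ P) Q = trans (⟦add⟧ μ c (P +ᴾ Q))
      (trans (cong (⟦ μ ⟧ᴹ * c +_) (⟦+ᴾ⟧ P Q)) (sym (+-assoc (⟦ μ ⟧ᴹ * c) _ _)))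

    ⟦scale⟧ : ∀ μ c Q → ⟦ scale μ c Q ⟧ᵖ ≡ ⟦ μ ⟧ᴹ * c * ⟦ Q ⟧ᵖ
    ⟦scale⟧ μ c []            = sym (*-zeroʳ (⟦ μ ⟧ᴹ * c))
    ⟦scale⟧ μ c ((ν , d) ∷ Q) = trans (⟦add⟧ (μ ·ᴹ ν) (c * d) (scale μ c Q))
      (trans (cong₂ (λ x y → x * (c * d) + y) (⟦·ᴹ⟧ μ ν) (⟦scale⟧ μ c Q)) (eq ⟦ μ ⟧ᴹ ⟦ ν ⟧ᴹ c d ⟦ Q ⟧ᵖ))
      where
      eq : ∀ m n c d q → m * n * (c * d) + m * c * q ≡ m * c * (n * d + q)
      eq = solve-∀

    ⟦*ᴾ⟧ : ∀ P Q → ⟦ P *ᴾ Q ⟧ᵖ ≡ ⟦ P ⟧ᵖ * ⟦ Q ⟧ᵖ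
    ⟦*ᴾ⟧ []            Q = refl
    ⟦*ᴾ⟧ ((μ , c) ∷ P) Q = trans (⟦+ᴾ⟧ (scale μ c Q) (P *ᴾ Q))
      (trans (cong₂ _+_ (⟦scale⟧ μ c Q) (⟦*ᴾ⟧ P Q)) (sym (*-distribʳ-+ ⟦ Q ⟧ᵖ (⟦ μ ⟧ᴹ * c) ⟦ P ⟧ᵖ)))

    ⟦poly⟧ : ∀ e → ⟦ poly e ⟧ᵖ ≡ ⟦ ρ ⟧ e
    ⟦poly⟧ (var i) = trans (+-identityʳ _) (trans (*-identityʳ _) (*-identityʳ _))
    ⟦poly⟧ (# c)   = trans (+-identityʳ _) (+-identityʳ c)
    ⟦poly⟧ (a ⊕ b) = trans (⟦+ᴾ⟧ (poly a) (poly b)) (cong₂ _+_ (⟦poly⟧ a) (⟦poly⟧ b))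
    ⟦poly⟧ (a ⊗ b) = trans (⟦*ᴾ⟧ (poly a) (poly b)) (cong₂ _*_ (⟦poly⟧ a) (⟦poly⟧ b))

    ⟦delete⟧ : ∀ μ Q → ⟦ μ ⟧ᴹ * coeff μ Q + ⟦ delete μ Q ⟧ᵖ ≡ ⟦ Q ⟧ᵖ
    ⟦delete⟧ μ [] = trans (+-identityʳ _) (*-zeroʳ ⟦ μ ⟧ᴹ)
    ⟦delete⟧ μ ((ν , d) ∷ Q) with ≡-dec Nat._≟_ μ ν
    ... | yes refl = refl
    ... | no  _    = trans (+-exchange (⟦ μ ⟧ᴹ * coeff μ Q) (⟦ ν ⟧ᴹ * d) ⟦ delete μ Q ⟧ᵖ) (cong (⟦ ν ⟧ᴹ * d +_) (⟦delete⟧ μ Q))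

    ≤ᴾ-sound : ∀ P Q → T (P ≤ᴾ Q) → ⟦ P ⟧ᵖ ≤ ⟦ Q ⟧ᵖ
    ≤ᴾ-sound []            Q _ = z≤n
    ≤ᴾ-sound ((μ , c) ∷ P) Q t with Equivalence.to T-∧ t
    ... | t₁ , t₂ = ≤-trans
      (+-mono-≤ (*-monoʳ-≤ ⟦ μ ⟧ᴹ (≤ᵇ⇒≤ c (coeff μ Q) t₁)) (≤ᴾ-sound P (delete μ Q) t₂))
      (≤-reflexive (⟦delete⟧ μ Q))

    check-sound : ∀ P l r → T (check P l r) → ⟦ ρ ⟧ r ≤ ⟦ ρ ⟧ l → ⟦ ρ ⟧ᴾ P
    check-sound (goal (a ⊑ b)) l r t r≤l = +-cancelʳ-≤ (⟦ ρ ⟧ r) (⟦ ρ ⟧ a) (⟦ ρ ⟧ b)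
      (≤-trans (+-monoʳ-≤ (⟦ ρ ⟧ a) r≤l)
        (subst₂ _≤_ (⟦poly⟧ (a ⊕ l)) (⟦poly⟧ (b ⊕ r)) (≤ᴾ-sound (poly (a ⊕ l)) (poly (b ⊕ r)) t)))
    check-sound ((a ⊑ b) ⟨ c ⟩⇒ P) l r t r≤l a≤b =
      check-sound P (l ⊕ c ⊗ b) (r ⊕ c ⊗ a) t (+-mono-≤ r≤l (*-monoʳ-≤ (⟦ ρ ⟧ c) a≤b))

  vars : ∀ n → Vec Expr n
  vars n = tabulate (λ i → var (toℕ i))

  -- The implicit argument reduces to the unit type once the check succeeds, so evaluation supplies
  -- it; the hypotheses listed by `f` follow as ordinary arguments.
  certify : ∀ {n} (ρ : Vec ℕ n) (f : N-ary n Expr Problem) →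
            {T (check (f $ⁿ vars n) (# 0) (# 0))} → ⟦ ρ ⟧ᴾ (f $ⁿ vars n)
  certify ρ f {t} = check-sound ρ (f $ⁿ vars _) (# 0) (# 0) t z≤n

  -- Sums over lists

  ∑ : {A : Set} → List A → (A → ℕ) → ℕ
  ∑ []       f = 0
  ∑ (x ∷ xs) f = f x + ∑ xs f

  ∥_∥ : {A : Set} → List A → ℕ
  ∥ xs ∥ = ∑ xs (λ _ → 1)

  ind : Bool → ℕ
  ind true  = 1
  ind false = 0

  ind≤1 : ∀ b → ind b ≤ 1
  ind≤1 true  = s≤s z≤n
  ind≤1 false = z≤n

  ∥∥≡length : {A : Set} (xs : List A) → ∥ xs ∥ ≡ length xs
  ∥∥≡length []       = refl
  ∥∥≡length (x ∷ xs) = cong suc (∥∥≡length xs)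

  ∑-zero : {A : Set} (xs : List A) → ∑ xs (λ _ → 0) ≡ 0
  ∑-zero []       = refl
  ∑-zero (x ∷ xs) = ∑-zero xs

  -- Linear combinations are kept as syntax so that `∑-lin-≤` turns a pointwise inequality into one
  -- between sums with the coefficients outside, the form that `certify` takes.
  data Lin (A : Set) : Set where
    [_∙_]  : (A → ℕ) → ℕ → Lin A
    _⊞_∙_ : Lin A → (A → ℕ) → ℕ → Lin A

  infixl 5 _⊞_∙_

  module _ {A : Set} where

    at : Lin A → A → ℕ
    at [ f ∙ c ]     x = f x * c
    at (l ⊞ f ∙ c) x = at l x + f x * c

    total : List A → Lin A → ℕ
    total xs [ f ∙ c ]     = ∑ xs f * c
    total xs (l ⊞ f ∙ c) = total xs l + ∑ xs f * c

    ∑-cong : ∀ xs {f g : A → ℕ} → (∀ x → f x ≡ g x) → ∑ xs f ≡ ∑ xs g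
    ∑-cong []       eq = refl
    ∑-cong (x ∷ xs) eq = cong₂ _+_ (eq x) (∑-cong xs eq)

    ∑-mono : ∀ {xs} {f g : A → ℕ} → All (λ x → f x ≤ g x) xs → ∑ xs f ≤ ∑ xs g
    ∑-mono []       = z≤n
    ∑-mono (p ∷ ps) = +-mono-≤ p (∑-mono ps)

    ∑-⊆ : ∀ {xs ys} (f : A → ℕ) → xs ⊆ ys → ∑ xs f ≤ ∑ ys f
    ∑-⊆ f []         = z≤n
    ∑-⊆ f (y ∷ʳ s)   = ≤-trans (∑-⊆ f s) (m≤n+m _ (f y))
    ∑-⊆ f (refl ∷ s) = +-monoʳ-≤ _ (∑-⊆ f s)

    ∑-+ : ∀ xs (f g : A → ℕ) → ∑ xs (λ x → f x + g x) ≡ ∑ xs f + ∑ xs g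
    ∑-+ []       f g = refl
    ∑-+ (x ∷ xs) f g = trans (cong (f x + g x +_) (∑-+ xs f g)) (+-interchange (f x) (g x) _ _)

    ∑-* : ∀ xs (f : A → ℕ) c → ∑ xs (λ x → f x * c) ≡ ∑ xs f * c
    ∑-* []       f c = refl
    ∑-* (x ∷ xs) f c = trans (cong (f x * c +_) (∑-* xs f c)) (sym (*-distribʳ-+ c (f x) (∑ xs f)))

    ∑-lin : ∀ xs l → ∑ xs (at l) ≡ total xs l
    ∑-lin xs [ f ∙ c ]     = ∑-* xs f c
    ∑-lin xs (l ⊞ f ∙ c) = trans (∑-+ xs (at l) (λ x → f x * c)) (cong₂ _+_ (∑-lin xs l) (∑-* xs f c))

    ∑-lin-≤ : ∀ xs l r → (∀ x → at l x ≤ at r x) → total xs l ≤ total xs r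
    ∑-lin-≤ xs l r p = subst₂ _≤_ (∑-lin xs l) (∑-lin xs r) (∑-mono (All.universal p xs))

    ∑-swap : ∀ {B : Set} xs (ys : List B) (f : A → B → ℕ) →
             ∑ xs (λ x → ∑ ys (f x)) ≡ ∑ ys (λ y → ∑ xs (λ x → f x y))
    ∑-swap []       ys f = sym (∑-zero ys)
    ∑-swap (x ∷ xs) ys f = trans (cong (∑ ys (f x) +_) (∑-swap xs ys f)) (go ys)
      where
      go : ∀ ys → ∑ ys (f x) + ∑ ys (λ y → ∑ xs (λ x → f x y)) ≡ ∑ ys (λ y → f x y + ∑ xs (λ x → f x y))
      go []       = refl
      go (y ∷ ys) = trans (+-interchange (f x y) _ _ _) (cong (f x y + ∑ xs (λ x → f x y) +_) (go ys))

    ∑-bound : ∀ {xs} {f : A → ℕ} {c} → All (λ x → f x ≤ c) xs → ∑ xs f ≤ ∥ xs ∥ * c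
    ∑-bound []       = z≤n
    ∑-bound (p ∷ ps) = +-mono-≤ p (∑-bound ps)

    ∑-bound′ : ∀ {xs} {f : A → ℕ} {c} → All (λ x → c ≤ f x) xs → ∥ xs ∥ * c ≤ ∑ xs f
    ∑-bound′ []       = z≤n
    ∑-bound′ (p ∷ ps) = +-mono-≤ p (∑-bound′ ps)

    filterᵇ-⊆ : ∀ (P : A → Bool) xs → filterᵇ P xs ⊆ xs
    filterᵇ-⊆ P []       = []
    filterᵇ-⊆ P (x ∷ xs) with P x
    ... | true  = refl ∷ filterᵇ-⊆ P xs
    ... | false = x ∷ʳ filterᵇ-⊆ P xs

    all-filterᵇ : ∀ (P : A → Bool) xs → All (λ x → P x ≡ true) (filterᵇ P xs)
    all-filterᵇ P []       = []
    all-filterᵇ P (x ∷ xs) with P x in eq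
    ... | true  = eq ∷ all-filterᵇ P xs
    ... | false = all-filterᵇ P xs

    all-filterᵇ-not : ∀ (P : A → Bool) xs → All (λ x → P x ≡ false) (filterᵇ (not ∘ P) xs)
    all-filterᵇ-not P []       = []
    all-filterᵇ-not P (x ∷ xs) with P x in eq
    ... | true  = all-filterᵇ-not P xs
    ... | false = eq ∷ all-filterᵇ-not P xs

    ∑-split : ∀ (P : A → Bool) xs (f : A → ℕ) → ∑ (filterᵇ P xs) f + ∑ (filterᵇ (not ∘ P) xs) f ≡ ∑ xs f
    ∑-split P []       f = refl
    ∑-split P (x ∷ xs) f with P x
    ... | true  = trans (+-assoc (f x) _ _) (cong (f x +_) (∑-split P xs f))
    ... | false = trans (trans (cong (∑ (filterᵇ P xs) f +_) (+-comm (f x) _))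
                    (trans (sym (+-assoc (∑ (filterᵇ P xs) f) _ _)) (+-comm _ (f x)))) (cong (f x +_) (∑-split P xs f))

    ∑-ind : ∀ (P : A → Bool) xs → ∑ xs (ind ∘ P) ≡ ∥ filterᵇ P xs ∥
    ∑-ind P []       = refl
    ∑-ind P (x ∷ xs) with P x
    ... | true  = cong suc (∑-ind P xs)
    ... | false = ∑-ind P xs

    AllPairs-⊆ : ∀ {R : A → A → Set} {xs ys} → xs ⊆ ys → AllPairs R ys → AllPairs R xs
    AllPairs-⊆ []         []       = []
    AllPairs-⊆ (_ ∷ʳ s)   (_ ∷ ps) = AllPairs-⊆ s ps
    AllPairs-⊆ (refl ∷ s) (p ∷ ps) = All-resp-⊆ s p ∷ AllPairs-⊆ s ps

    choose : ∀ m (xs : List A) → m ≤ ∥ xs ∥ → ∃ λ ys → ys ⊆ xs × ∥ ys ∥ ≡ m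
    choose zero    xs       _       = [] , minimum xs , refl
    choose (suc m) (x ∷ xs) (s≤s h) with choose m xs h
    ... | ys , s , eq = x ∷ ys , refl ∷ s , cong suc eq

  -- Gram matrices

  module _ {A B : Set} (W : List A) (F H : B → A → ℕ) where

    ∑-cross₁ : ∀ s c (f : A → ℕ) {U} → All (λ v → ∑ W (λ w → f w * H v w) * s ≤ c) U →
               ∑ W (λ w → f w * ∑ U (λ v → H v w)) * s ≤ ∥ U ∥ * c
    ∑-cross₁ s c f {[]} [] = ≤-reflexive (cong (_* s)
      (trans (∑-cong W (λ w → *-zeroʳ (f w))) (∑-zero W)))
    ∑-cross₁ s c f {v ∷ U} (p ∷ ps) = ≤-trans
      (≤-reflexive (trans (cong (_* s) (trans (∑-cong W (λ w → *-distribˡ-+ (f w) (H v w) _))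
        (∑-+ W (λ w → f w * H v w) (λ w → f w * ∑ U (λ v → H v w))))) (*-distribʳ-+ s (∑ W (λ w → f w * H v w)) _)))
      (+-mono-≤ p (∑-cross₁ s c f ps))

    -- Bilinearity; `s` is the denominator of the bound `c / s` on a single inner product.
    ∑-cross : ∀ s c {U U′} → All (λ u → All (λ v → ∑ W (λ w → F u w * H v w) * s ≤ c) U′) U →
              ∑ W (λ w → ∑ U (λ u → F u w) * ∑ U′ (λ v → H v w)) * s ≤ ∥ U ∥ * (∥ U′ ∥ * c)
    ∑-cross s c {[]} [] = ≤-reflexive (cong (_* s) (∑-zero W))
    ∑-cross s c {u ∷ U} {U′} (p ∷ ps) = ≤-trans
      (≤-reflexive (trans (cong (_* s) (trans (∑-cong W (λ w → *-distribʳ-+ (∑ U′ (λ v → H v w)) (F u w) _))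
        (∑-+ W (λ w → F u w * ∑ U′ (λ v → H v w)) _))) (*-distribʳ-+ s (∑ W (λ w → F u w * ∑ U′ (λ v → H v w))) _)))
      (+-mono-≤ (∑-cross₁ s c (F u) p) (∑-cross s c ps))

  -- Expanding `(F u + S)²` for the first row u leaves its norm, twice its products with the later
  -- rows, and the square of the rest. The number of ordered pairs of distinct rows is rounded up to
  -- the square of `∥ U ∥`.
  ∑-gram : ∀ {A B : Set} (W : List A) (F : B → A → ℕ) s c d {U} →
    All (λ u → ∑ W (λ w → F u w * F u w) ≤ d) U →
    AllPairs (λ u v → ∑ W (λ w → F u w * F v w) * s ≤ c) U →
    ∑ W (λ w → ∑ U (λ u → F u w) * ∑ U (λ u → F u w)) * s ≤ ∥ U ∥ * d * s + ∥ U ∥ * ∥ U ∥ * c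
  ∑-gram W F s c d {[]}    []       []       = ≤-reflexive (cong (_* s) (∑-zero W))
  ∑-gram {A} W F s c d {u ∷ U} (p ∷ ps) (r ∷ rs) =
    certify (∑ W (λ w → (F u w + S w) * (F u w + S w)) ∷ ∑ W (λ w → F u w * F u w) ∷ ∑ W (λ w → F u w * S w) ∷
        ∑ W (λ w → S w * S w) ∷ s ∷ c ∷ d ∷ ∥ U ∥ ∷ []) (λ X x y z s c d u →
      (X · 1 ⊑ x · 1 ⊕ y · 2 ⊕ z · 1) ⟨ s ⟩⇒ (x ⊑ d) ⟨ s ⟩⇒ (y ⊗ s ⊑ u ⊗ c) ⟨ # 2 ⟩⇒
      (z ⊗ s ⊑ u ⊗ d ⊗ s ⊕ u ⊗ u ⊗ c) ⟨ # 1 ⟩⇒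
      goal (X ⊗ s ⊑ (# 1 ⊕ u) ⊗ d ⊗ s ⊕ (# 1 ⊕ u) ⊗ (# 1 ⊕ u) ⊗ c))
    (∑-lin-≤ W [ (λ w → (F u w + S w) * (F u w + S w)) ∙ 1 ]
      ([ (λ w → F u w * F u w) ∙ 1 ] ⊞ (λ w → F u w * S w) ∙ 2 ⊞ (λ w → S w * S w) ∙ 1)
      (λ w → certify (F u w ∷ S w ∷ []) (λ f S → goal ((f ⊕ S) ⊗ (f ⊕ S) · 1 ⊑ f ⊗ f · 1 ⊕ f ⊗ S · 2 ⊕ S ⊗ S · 1))))
    p (∑-cross₁ W F F s c (F u) r) (∑-gram W F s c d ps rs)
    where
    S : A → ℕ
    S w = ∑ U (λ u → F u w)

  2ab≤a²+b² : ∀ a b → a * b * 2 ≤ a * a + b * b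
  2ab≤a²+b² zero    b       = z≤n
  2ab≤a²+b² (suc a) zero    = ≤-trans (≤-reflexive (cong (_* 2) (*-zeroʳ a))) z≤n
  2ab≤a²+b² (suc a) (suc b) = certify (a ∷ b ∷ []) (λ a b → (a ⊗ b · 2 ⊑ a ⊗ a ⊕ b ⊗ b) ⟨ # 1 ⟩⇒
    goal ((# 1 ⊕ a) ⊗ (# 1 ⊕ b) · 2 ⊑ (# 1 ⊕ a) ⊗ (# 1 ⊕ a) ⊕ (# 1 ⊕ b) ⊗ (# 1 ⊕ b))) (2ab≤a²+b² a b)

  -- Ramsey's theorem and related selections from lists

  m+n≤a+b : ∀ {m n a b} → m + n ≤ a + b → m ≤ a ⊎ n ≤ b
  m+n≤a+b {m} {n} {a} {b} h with m ≤? a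
  ... | yes m≤a = inj₁ m≤a
  ... | no  m≰a with n ≤? b
  ...   | yes n≤b = inj₂ n≤b
  ...   | no  n≰b = contradiction h (<⇒≱ (+-mono-< (≰⇒> m≰a) (≰⇒> n≰b)))

  ram : ℕ → ℕ → ℕ
  ram zero    _       = 0
  ram (suc a) zero    = 0
  ram (suc a) (suc b) = suc (ram a (suc b) + ram (suc a) b)

  module _ {A : Set} where

    ramsey : ∀ (R : A → A → Bool) a b xs → ram a b ≤ ∥ xs ∥ →
      (∃ λ ys → ys ⊆ xs × ∥ ys ∥ ≡ a × AllPairs (λ u v → R u v ≡ true) ys) ⊎
      (∃ λ ys → ys ⊆ xs × ∥ ys ∥ ≡ b × AllPairs (λ u v → R u v ≡ false) ys)
    ramsey R zero    b       xs _ = inj₁ ([] , minimum xs , refl , [])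
    ramsey R (suc a) zero    xs _ = inj₂ ([] , minimum xs , refl , [])
    ramsey R (suc a) (suc b) (x ∷ xs) (s≤s h)
      with m+n≤a+b (≤-trans h (≤-reflexive (sym (∑-split (R x) xs (λ _ → 1)))))
    ... | inj₁ h₁ with ramsey R a (suc b) (filterᵇ (R x) xs) h₁
    ...   | inj₁ (ys , s , eq , ps) =
            inj₁ (x ∷ ys , refl ∷ ⊆-trans s (filterᵇ-⊆ _ xs) , cong suc eq , All-resp-⊆ s (all-filterᵇ _ xs) ∷ ps)
    ...   | inj₂ (ys , s , eq , ps) = inj₂ (ys , x ∷ʳ ⊆-trans s (filterᵇ-⊆ _ xs) , eq , ps)
    ramsey R (suc a) (suc b) (x ∷ xs) (s≤s h)
        | inj₂ h₂ with ramsey R (suc a) b (filterᵇ (not ∘ R x) xs) h₂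
    ...   | inj₁ (ys , s , eq , ps) = inj₁ (ys , x ∷ʳ ⊆-trans s (filterᵇ-⊆ _ xs) , eq , ps)
    ...   | inj₂ (ys , s , eq , ps) =
            inj₂ (x ∷ ys , refl ∷ ⊆-trans s (filterᵇ-⊆ _ xs) , cong suc eq , All-resp-⊆ s (all-filterᵇ-not _ xs) ∷ ps)

    quantile : ∀ (f : A → ℕ) r xs → 1 ≤ r → r ≤ ∥ xs ∥ →
      ∃ λ t → r ≤ ∥ filterᵇ (λ x → f x <ᵇ suc t) xs ∥ × ∥ filterᵇ (λ x → f x <ᵇ t) xs ∥ < r
    -- No value exceeds the sum of all values, so the downward search for the threshold starts
    -- there.
    quantile f r xs 1≤r r≤ = search (∑ xs f) (≤-trans r≤ (≤-reflexive (sym (all-below xs ≤-refl))))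
      where
      all-below : ∀ ys {b} → ∑ ys f ≤ b → ∥ filterᵇ (λ x → f x <ᵇ suc b) ys ∥ ≡ ∥ ys ∥
      all-below []       h = refl
      all-below (y ∷ ys) {b} h with f y <ᵇ suc b in eq
      ... | true  = cong suc (all-below ys (≤-trans (m≤n+m _ (f y)) h))
      ... | false = contradiction (<⇒<ᵇ (s≤s (≤-trans (m≤m+n (f y) _) h))) (subst (λ b → ¬ T b) (sym eq) (λ ()))
      none : ∀ ys → ∥ filterᵇ (λ x → f x <ᵇ 0) ys ∥ ≡ 0
      none []       = refl
      none (y ∷ ys) with f y
      ... | zero  = none ys
      ... | suc _ = none ys
      search : ∀ b → r ≤ ∥ filterᵇ (λ x → f x <ᵇ suc b) xs ∥ →
        ∃ λ t → r ≤ ∥ filterᵇ (λ x → f x <ᵇ suc t) xs ∥ × ∥ filterᵇ (λ x → f x <ᵇ t) xs ∥ < r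
      search zero    h = 0 , h , ≤-trans (s≤s (≤-reflexive (none xs))) 1≤r
      search (suc b) h with r ≤? ∥ filterᵇ (λ x → f x <ᵇ suc b) xs ∥
      ... | yes h′ = search b h′
      ... | no  h′ = suc b , h , ≰⇒> h′

  module _ {A B : Set} (R : B → A → Bool) where

    -- Each q keeps a class of xs, related or unrelated, at the price of a factor 2. All survivors
    -- then have the trace `qs′` on `qs`, and the count makes the size of `qs′` their common degree.
    homogeneous : ∀ qs xs r → 2 ^ ∥ qs ∥ * r ≤ ∥ xs ∥ →
      ∃ λ qs′ → ∃ λ ys → qs′ ⊆ qs × ys ⊆ xs × r ≤ ∥ ys ∥ ×
        All (λ y → All (λ q → R q y ≡ true) qs′ × ∑ qs (λ q → ind (R q y)) ≡ ∥ qs′ ∥) ys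
    homogeneous [] xs r h = [] , xs , [] , ⊆-refl , subst (_≤ _) (+-identityʳ r) h , All.universal (λ _ → [] , refl) xs
    homogeneous (q ∷ qs) xs r h with m+n≤a+b (≤-trans (≤-reflexive (eq (2 ^ ∥ qs ∥) r))
                                       (≤-trans h (≤-reflexive (sym (∑-split (R q) xs (λ _ → 1))))))
      where
      eq : ∀ a r → a * r + a * r ≡ (a + (a + 0)) * r
      eq a r = trans (sym (*-distribʳ-+ r a a)) (cong (λ b → (a + b) * r) (sym (+-identityʳ a)))
    ... | inj₁ h₁ with homogeneous qs (filterᵇ (R q) xs) r h₁
    ...   | qs′ , ys , s , s′ , r≤ , ps =
            q ∷ qs′ , ys , refl ∷ s , ⊆-trans s′ (filterᵇ-⊆ _ xs) , r≤ ,
            All.zipWith (λ {y} (e , a , c) → e ∷ a , trans (cong (λ b → ind b + ∑ qs (λ q → ind (R q y))) e) (cong suc c)) (All-resp-⊆ s′ (all-filterᵇ _ xs) , ps)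
    homogeneous (q ∷ qs) xs r h
        | inj₂ h₂ with homogeneous qs (filterᵇ (not ∘ R q) xs) r h₂
    ...   | qs′ , ys , s , s′ , r≤ , ps =
            qs′ , ys , q ∷ʳ s , ⊆-trans s′ (filterᵇ-⊆ _ xs) , r≤ ,
            All.zipWith (λ {y} (e , a , c) → a , trans (cong (λ b → ind b + ∑ qs (λ q → ind (R q y))) e) c) (All-resp-⊆ s′ (all-filterᵇ-not _ xs) , ps)

    -- The common trace found by `homogeneous` has the size of a degree, hence at least m. This is a
    -- crude Kővári-Sós-Turán theorem.
    common : ∀ m qs xs r → 1 ≤ r → 2 ^ ∥ qs ∥ * r ≤ ∥ xs ∥ → All (λ x → m ≤ ∑ qs (λ q → ind (R q x))) xs →
      ∃ λ qs′ → ∃ λ ys → qs′ ⊆ qs × ∥ qs′ ∥ ≡ m × ys ⊆ xs × r ≤ ∥ ys ∥ × All (λ q → All (λ y → R q y ≡ true) ys) qs′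
    common m qs xs r 1≤r h big with homogeneous qs xs r h
    ... | qs′ , []     , s , s′ , r≤ , _ = contradiction (≤-trans 1≤r r≤) (λ ())
    ... | qs′ , y ∷ ys , s , s′ , r≤ , ps@((_ , c) ∷ _)
      with choose m qs′ (≤-trans (All.head (All-resp-⊆ s′ big)) (≤-reflexive c))
    ...   | qs″ , s″ , eq = qs″ , y ∷ ys , ⊆-trans s″ s , eq , s′ , r≤ ,
            All.tabulate (λ q∈ → All.map (λ (a , _) → All.lookup (All-resp-⊆ s″ a) q∈) ps)

    -- Averaging: a popular x contributes at most `∥ qs ∥`, any other at most m.
    popular : ∀ m qs xs → ∑ xs (λ x → ∑ qs (λ q → ind (R q x))) ≤
      ∥ filterᵇ (λ x → m <ᵇ suc (∑ qs (λ q → ind (R q x)))) xs ∥ * ∥ qs ∥ + ∥ xs ∥ * m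
    popular m qs []       = z≤n
    popular m qs (x ∷ xs) with popular m qs xs | m <ᵇ suc (∑ qs (λ q → ind (R q x))) in eq
    ... | ih | true  = certify (∑ qs (λ q → ind (R q x)) ∷ ∥ qs ∥ ∷ ∑ xs (λ x → ∑ qs (λ q → ind (R q x))) ∷
        ∥ filterᵇ (λ x → m <ᵇ suc (∑ qs (λ q → ind (R q x)))) xs ∥ ∷ ∥ xs ∥ ∷ m ∷ [])
      (λ a u S s y m → (a ⊑ u) ⟨ # 1 ⟩⇒ (S ⊑ s ⊗ u ⊕ y ⊗ m) ⟨ # 1 ⟩⇒ goal (a ⊕ S ⊑ (# 1 ⊕ s) ⊗ u ⊕ (# 1 ⊕ y) ⊗ m))
      (∑-mono (All.universal (λ q → ind≤1 (R q x)) qs)) ih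
    ... | ih | false = certify (∑ qs (λ q → ind (R q x)) ∷ ∥ qs ∥ ∷ ∑ xs (λ x → ∑ qs (λ q → ind (R q x))) ∷
        ∥ filterᵇ (λ x → m <ᵇ suc (∑ qs (λ q → ind (R q x)))) xs ∥ ∷ ∥ xs ∥ ∷ m ∷ [])
      (λ a u S s y m → (a ⊑ m) ⟨ # 1 ⟩⇒ (S ⊑ s ⊗ u ⊕ y ⊗ m) ⟨ # 1 ⟩⇒ goal (a ⊕ S ⊑ s ⊗ u ⊕ (# 1 ⊕ y) ⊗ m))
      (≮⇒≥ (λ lt → contradiction (<⇒<ᵇ (s≤s (<⇒≤ lt))) (subst (λ b → ¬ T b) (sym eq) (λ ())))) ih

  -- Graphs as matrices

  1≰0 : ¬ (1 ≤ 0)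
  1≰0 ()

  <ᵇ-true : ∀ {m n} → (m <ᵇ n) ≡ true → m < n
  <ᵇ-true eq = <ᵇ⇒< _ _ (subst T (sym eq) _)

  <ᵇ-false : ∀ {m n} → (m <ᵇ n) ≡ false → n ≤ m
  <ᵇ-false eq = ≮⇒≥ (λ lt → subst T eq (<⇒<ᵇ lt))

  AllPairs-map₂ : ∀ {A : Set} {P : A → Set} {R S : A → A → Set} {xs} →
    (∀ {x y} → P x → P y → R x y → S x y) → All P xs → AllPairs R xs → AllPairs S xs
  AllPairs-map₂ f []       []       = []
  AllPairs-map₂ f (p ∷ ps) (r ∷ rs) = All.zipWith (λ (q , s) → f p q s) (ps , r) ∷ AllPairs-map₂ f ps rs

  -- The expansion of `x̄² = (k − x)²`, rearranged without subtraction; `complement-product` does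
  -- the same for `(m − x)(m − y)`.
  complement-square : ∀ x x̄ {k} → x + x̄ ≡ k → k * k + x * x ≤ x̄ * x̄ + x * k * 2
  complement-square x x̄ refl =
    certify (x ∷ x̄ ∷ []) (λ x x̄ → goal ((x ⊕ x̄) ⊗ (x ⊕ x̄) ⊕ x ⊗ x ⊑ x̄ ⊗ x̄ ⊕ x ⊗ (x ⊕ x̄) · 2))

  complement-product : ∀ x x̄ y ȳ {m} → x + x̄ ≡ m → y + ȳ ≡ m → m * m + x * y ≤ x̄ * ȳ + x * m + y * m
  complement-product x x̄ y ȳ refl e = certify (x ∷ x̄ ∷ y ∷ ȳ ∷ []) (λ x x̄ y ȳ → (x ⊕ x̄ ⊑ y ⊕ ȳ) ⟨ x̄ ⟩⇒
    goal ((x ⊕ x̄) ⊗ (x ⊕ x̄) ⊕ x ⊗ y ⊑ x̄ ⊗ ȳ ⊕ x ⊗ (x ⊕ x̄) ⊕ y ⊗ (x ⊕ x̄))) (≤-reflexive (sym e))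

  ∑-eq≤1 : ∀ {n} (q : Fin n) {xs} → AllPairs _≢_ xs → ∑ xs (λ w → ind ⌊ q ≟ w ⌋) ≤ 1
  ∑-eq≤1 q []                = z≤n
  ∑-eq≤1 q {x ∷ xs} (p ∷ ps) with q ≟ x
  ... | no _     = ∑-eq≤1 q ps
  ... | yes refl = s≤s (≤-reflexive (none p))
    where
    none : ∀ {ys} → All (q ≢_) ys → ∑ ys (λ w → ind ⌊ q ≟ w ⌋) ≡ 0
    none []                = refl
    none {y ∷ ys} (r ∷ rs) with q ≟ y
    ... | yes e = contradiction e r
    ... | no _  = none rs

  ∧-true : ∀ {a b} → a ∧ b ≡ true → a ≡ true × b ≡ true
  ∧-true {true} {true} _ = refl , refl

  module Counting {n : ℕ} (G : Graph n) where

    V : List (Fin n)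
    V = allFin n

    α β : Fin n → Fin n → ℕ
    α u w = ind (adj G u w)
    β u w = ind (not (adj G u w))

    deg con : List (Fin n) → Fin n → ℕ
    deg U w = ∑ U (λ u → α u w)
    con U w = ∑ U (λ u → β u w)

    d : Fin n → ℕ
    d u = ∑ V (α u)

    -- A vertex is its own non-neighbour, so `conon u v` includes u and v themselves when they are
    -- non-adjacent. Fewer than q pages in the complement thus means at most `q + 1` here.
    codeg conon : Fin n → Fin n → ℕ
    codeg u v = ∑ V (λ w → α u w * α v w)
    conon u v = ∑ V (λ w → β u w * β v w)

    Indep Clique : List (Fin n) → Set
    Indep  = AllPairs (λ u v → u ≢ v × adj G u v ≡ false)
    Clique = AllPairs (λ u v → adj G u v ≡ true)

    Joined : List (Fin n) → List (Fin n) → Set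
    Joined U W = All (λ u → All (λ w → adj G u w ≡ true) W) U

    ∥V∥≡n : ∥ V ∥ ≡ n
    ∥V∥≡n = trans (∥∥≡length V) (length-tabulate id)

    deg+con : ∀ U w → deg U w + con U w ≡ ∥ U ∥
    deg+con []      w = refl
    deg+con (u ∷ U) w with adj G u w
    ... | true  = cong suc (deg+con U w)
    ... | false = trans (+-suc (deg U w) (con U w)) (cong suc (deg+con U w))

    square≤ : ∀ (f : Fin n → Bool) → ∑ V (λ w → ind (f w) * ind (f w)) ≤ n
    square≤ f = ≤-trans (∑-mono (All.universal (λ w → *-mono-≤ (ind≤1 (f w)) (ind≤1 (f w))) V)) (≤-reflexive ∥V∥≡n)

    conon+d+d : ∀ u v → conon u v + d u + d v ≡ n + codeg u v
    conon+d+d u v = trans (sym (trans (∑-+ V _ (α v)) (cong (_+ d v) (∑-+ V _ (α u)))))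
      (trans (∑-cong V (λ w → pointwise (adj G u w) (adj G v w)))
        (trans (∑-+ V (λ _ → 1) (λ w → α u w * α v w)) (cong (_+ codeg u v) ∥V∥≡n)))
      where
      pointwise : ∀ a b → ind (not a) * ind (not b) + ind a + ind b ≡ 1 + ind a * ind b
      pointwise true  true  = refl
      pointwise true  false = refl
      pointwise false true  = refl
      pointwise false false = refl

    ∑-deg : ∀ U → ∑ V (deg U) ≡ ∑ U d
    ∑-deg U = ∑-swap V U (λ w u → α u w)

    ⊆V⇒distinct : ∀ {P} → P ⊆ V → AllPairs _≢_ P
    ⊆V⇒distinct s = AllPairs-⊆ s (allFin⁺ n)

    Joined-sym : ∀ {U W} → Joined U W → Joined W U
    Joined-sym {U} {W} J = All.tabulate (λ w∈ → All.tabulate (λ u∈ →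
      trans (adj-sym G _ _) (All.lookup (All.lookup J u∈) w∈)))

  -- m₀ is a parameter because `ram 2000 _` must never be evaluated.
  module Bounded {n : ℕ} (G : Graph n) (p K m₀ : ℕ) (1≤n : 1 ≤ n) (2000≤m₀ : 2000 ≤ m₀)
    (p-small : p * 12 * K + n ≤ n * K) (12p≤n : p * 12 ≤ n)
    (codeg≤ : ∀ {u v} → adj G u v ≡ true → Counting.codeg G u v ≤ p)
    (conon≤ : ∀ {u v} → u ≢ v → adj G u v ≡ false → Counting.conon G u v * 2 ≤ n) where

    -- Second moments of independent and joined sets.

    open Counting G public

    -- Gram bound for the non-adjacency rows, with norms at most n and inner products at most n/2.
    -- Divided by `m² n` it reads ∫(1 - x)² ≤ 1/2 + 1/m.
    row : ∀ {U m} → Indep U → ∥ U ∥ ≡ m → ∑ V (λ w → con U w * con U w) * 2 ≤ m * n * 2 + m * m * n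
    row {U} I refl = ∑-gram V β 2 n n {U} (All.universal (λ u → square≤ (not ∘ adj G u)) U)
      (AllPairs.map (λ (ne , e) → conon≤ ne e) I)

    joined-sum : ∀ {U W m l} → Joined U W → ∥ U ∥ ≡ m → ∥ W ∥ ≡ l → ∑ V (λ w → deg U w * deg W w) * 1 ≤ m * (l * p)
    joined-sum J refl refl = ∑-cross V α α 1 p (All.map (All.map (λ e → ≤-trans (≤-reflexive (*-identityʳ _)) (codeg≤ e))) J)

    -- Sums x̄² + ȳ² + z̄² + 2(xy + yz + zx) = 2k² + (x + y + z − k)² over all vertices.
    no-triple : ∀ {A B C k} → K * 6 < k → Indep A → Indep B → Indep C → ∥ A ∥ ≡ k → ∥ B ∥ ≡ k → ∥ C ∥ ≡ k →
      Joined A B → Joined A C → Joined B C → ⊥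
    no-triple {A} {B} {C} {k} 6K<k IA IB IC ea eb ec AB AC BC = 1≰0 (certify
      (n ∷ p ∷ K ∷ k ∷ S A A ∷ S B B ∷ S C C ∷ D A B ∷ D A C ∷ D B C ∷ ∥ V ∥ ∷ [])
      (λ n p K k a b c ab ac bc v →
        (v ⊗ (k ⊗ k · 2) ⊑ a · 1 ⊕ b · 1 ⊕ c · 1 ⊕ ab · 2 ⊕ ac · 2 ⊕ bc · 2) ⟨ K · 2 ⟩⇒
        (n ⊑ v) ⟨ K ⊗ k ⊗ k · 4 ⟩⇒
        (a · 2 ⊑ k ⊗ n · 2 ⊕ k ⊗ k ⊗ n) ⟨ K ⟩⇒ (b · 2 ⊑ k ⊗ n · 2 ⊕ k ⊗ k ⊗ n) ⟨ K ⟩⇒ (c · 2 ⊑ k ⊗ n · 2 ⊕ k ⊗ k ⊗ n) ⟨ K ⟩⇒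
        (ab · 1 ⊑ k ⊗ (k ⊗ p)) ⟨ K · 4 ⟩⇒ (ac · 1 ⊑ k ⊗ (k ⊗ p)) ⟨ K · 4 ⟩⇒ (bc · 1 ⊑ k ⊗ (k ⊗ p)) ⟨ K · 4 ⟩⇒
        (p · 12 ⊗ K ⊕ n ⊑ n ⊗ K) ⟨ k ⊗ k ⟩⇒
        (# 1 ⊕ K · 6 ⊑ k) ⟨ k ⊗ n ⟩⇒ (# 1 ⊕ K · 6 ⊑ k) ⟨ n ⟩⇒ (# 1 ⊑ n) ⟨ # 1 ⟩⇒
        goal (# 1 ⊑ # 0))
      (∑-lin-≤ V [ (λ _ → 1) ∙ k * k * 2 ]
        ([ (λ w → con A w * con A w) ∙ 1 ] ⊞ (λ w → con B w * con B w) ∙ 1 ⊞ (λ w → con C w * con C w) ∙ 1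
          ⊞ (λ w → deg A w * deg B w) ∙ 2 ⊞ (λ w → deg A w * deg C w) ∙ 2 ⊞ (λ w → deg B w * deg C w) ∙ 2)
        (λ w → pointwise (con A w) (con B w) (con C w) (deg A w) (deg B w) (deg C w)
          (trans (deg+con A w) ea) (trans (deg+con B w) eb) (trans (deg+con C w) ec)))
      (≤-reflexive (sym ∥V∥≡n)) (row IA ea) (row IB eb) (row IC ec)
      (joined-sum AB ea eb) (joined-sum AC ea ec) (joined-sum BC eb ec) p-small 6K<k 6K<k 1≤n)
      where
      S D : List (Fin n) → List (Fin n) → ℕ
      S A B = ∑ V (λ w → con A w * con B w)
      D A B = ∑ V (λ w → deg A w * deg B w)
      pointwise : ∀ x̄ ȳ z̄ x y z → x + x̄ ≡ k → y + ȳ ≡ k → z + z̄ ≡ k →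
        1 * (k * k * 2) ≤ x̄ * x̄ * 1 + ȳ * ȳ * 1 + z̄ * z̄ * 1 + x * y * 2 + x * z * 2 + y * z * 2
      pointwise x̄ ȳ z̄ x y z ex ey ez = certify (x̄ ∷ ȳ ∷ z̄ ∷ x ∷ y ∷ z ∷ k ∷ []) (λ x̄ ȳ z̄ x y z k →
        (k ⊗ k ⊕ x ⊗ x ⊑ x̄ ⊗ x̄ ⊕ x ⊗ k · 2) ⟨ # 1 ⟩⇒ (k ⊗ k ⊕ y ⊗ y ⊑ ȳ ⊗ ȳ ⊕ y ⊗ k · 2) ⟨ # 1 ⟩⇒
        (k ⊗ k ⊕ z ⊗ z ⊑ z̄ ⊗ z̄ ⊕ z ⊗ k · 2) ⟨ # 1 ⟩⇒
        ((x ⊕ y ⊕ z) ⊗ k · 2 ⊑ (x ⊕ y ⊕ z) ⊗ (x ⊕ y ⊕ z) ⊕ k ⊗ k) ⟨ # 1 ⟩⇒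
        goal (# 1 ⊗ (k ⊗ k · 2) ⊑ x̄ ⊗ x̄ · 1 ⊕ ȳ ⊗ ȳ · 1 ⊕ z̄ ⊗ z̄ · 1 ⊕ x ⊗ y · 2 ⊕ x ⊗ z · 2 ⊕ y ⊗ z · 2))
        (complement-square x x̄ ex) (complement-square y ȳ ey) (complement-square z z̄ ez) (2ab≤a²+b² (x + y + z) k)

    -- Cliques and vertices of low degree.

    clique-sum : ∀ {U m} → AllPairs (λ u v → codeg u v * 12 ≤ n) U → ∥ U ∥ ≡ m →
      ∑ V (λ w → deg U w * deg U w) * 12 ≤ m * n * 12 + m * m * n
    clique-sum {U} ps refl = ∑-gram V α 12 n n {U} (All.universal (λ u → square≤ (adj G u)) U) ps

    adj⇒12codeg≤ : ∀ {u v} → adj G u v ≡ true → codeg u v * 12 ≤ n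
    adj⇒12codeg≤ e = ≤-trans (*-monoˡ-≤ 12 (codeg≤ e)) 12p≤n

    -- From (100x − 29m)² ≥ 0.
    deg-square-sum : ∀ U m → ∑ V (deg U) * (m * 5800) ≤ ∑ V (λ w → deg U w * deg U w) * 10000 + n * (m * m * 841)
    deg-square-sum U m = ≤-trans
      (∑-lin-≤ V [ deg U ∙ m * 5800 ] ([ (λ w → deg U w * deg U w) ∙ 10000 ] ⊞ (λ _ → 1) ∙ m * m * 841)
        (λ w → certify (deg U w ∷ m ∷ []) (λ x m → (x · 100 ⊗ (m · 29) · 2 ⊑ x · 100 ⊗ (x · 100) ⊕ m · 29 ⊗ (m · 29)) ⟨ # 1 ⟩⇒
            goal (x ⊗ (m · 5800) ⊑ x ⊗ x · 10000 ⊕ # 1 ⊗ (m ⊗ m · 841))) (2ab≤a²+b² (deg U w * 100) (m * 29))))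
      (+-monoʳ-≤ (∑ V (λ w → deg U w * deg U w) * 10000) (≤-reflexive (cong (_* (m * m * 841)) ∥V∥≡n)))

    -- The density x towards U has mean at least 0.29, while ∫x² ≤ 1/12 + 1/m. Since 0.29² = 0.0841
    -- > 1/12, this bounds m: the constants give 92 m ≤ 120000, which 2000 violates.
    no-clique : ∀ {U m} → 2000 ≤ m → ∥ U ∥ ≡ m → All (λ u → n * 29 ≤ d u * 100) U → Clique U → ⊥
    no-clique {U} {m} 2000≤m refl high C = 1≰0 (certify
      (n ∷ m ∷ ∑ V (λ w → deg U w * deg U w) ∷ ∑ V (deg U) ∷ [])
      (λ n m X D →
        (X · 12 ⊑ m ⊗ n · 12 ⊕ m ⊗ m ⊗ n) ⟨ # 10000 ⟩⇒
        (D ⊗ (m · 5800) ⊑ X · 10000 ⊕ n ⊗ (m ⊗ m · 841)) ⟨ # 12 ⟩⇒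
        (m ⊗ (n · 29) ⊑ D · 100) ⟨ m · 696 ⟩⇒
        (# 2000 ⊑ m) ⟨ m ⊗ n · 92 ⟩⇒ (# 2000 ⊑ m) ⟨ n ⟩⇒ (# 1 ⊑ n) ⟨ # 1 ⟩⇒
        goal (# 1 ⊑ # 0))
      (clique-sum (AllPairs.map adj⇒12codeg≤ C) refl) (deg-square-sum U m)
      (≤-trans (∑-bound′ high) (≤-reflexive (trans (∑-* U d 100) (cong (_* 100) (sym (∑-deg U))))))
      2000≤m 2000≤m 1≤n)

    low : Fin n → Bool
    low u = d u * 100 <ᵇ n * 29

    L M : List (Fin n)
    L = filterᵇ low V
    M = filterᵇ (not ∘ low) V

    L⊆V : L ⊆ V
    L⊆V = filterᵇ-⊆ low V

    M⊆V : M ⊆ V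
    M⊆V = filterᵇ-⊆ (not ∘ low) V

    L-low : All (λ u → d u * 100 ≤ n * 29) L
    L-low = All.map (λ e → <⇒≤ (<ᵇ-true e)) (all-filterᵇ low V)

    ∥L∥+∥M∥≡n : ∥ L ∥ + ∥ M ∥ ≡ n
    ∥L∥+∥M∥≡n = trans (∑-split low V (λ _ → 1)) ∥V∥≡n

    -- Vertices of `M` have degree at least 0.29 n, so `no-clique` rules out the clique alternative
    -- of Ramsey's theorem.
    independent-subset : ∀ r {P} → P ⊆ M → ram m₀ r ≤ ∥ P ∥ → ∃ λ U → U ⊆ P × ∥ U ∥ ≡ r × Indep U
    independent-subset r {P} P⊆M h with ramsey (adj G) m₀ r P h
    ... | inj₁ (U , s , eq , C) = contradiction C (no-clique 2000≤m₀ eq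
            (All-resp-⊆ (⊆-trans s P⊆M) (All.map <ᵇ-false (all-filterᵇ-not low V))))
    ... | inj₂ (U , s , eq , I) = U , s , eq , AllPairs.zip (⊆V⇒distinct (⊆-trans s (⊆-trans P⊆M M⊆V)) , I)

    -- For non-adjacent u and v, inclusion-exclusion gives at most (0.5 + 0.29 + 0.29 - 1) n = 0.08
    -- n < n/12. So `L` obeys the second-moment bound of a clique.
    low⇒12codeg≤ : ∀ {u v} → d u * 100 ≤ n * 29 → d v * 100 ≤ n * 29 → u ≢ v → codeg u v * 12 ≤ n
    low⇒12codeg≤ {u} {v} hu hv u≢v with adj G u v in eq
    ... | true  = adj⇒12codeg≤ eq
    ... | false = *-cancelʳ-≤ (codeg u v * 12) n 25 (certify (n ∷ codeg u v ∷ conon u v ∷ d u ∷ d v ∷ [])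
      (λ n c c̄ x y → (n ⊕ c ⊑ c̄ ⊕ x ⊕ y) ⟨ # 300 ⟩⇒ (c̄ · 2 ⊑ n) ⟨ # 150 ⟩⇒ (x · 100 ⊑ n · 29) ⟨ # 3 ⟩⇒ (y · 100 ⊑ n · 29) ⟨ # 3 ⟩⇒
        goal (c · 12 · 25 ⊑ n · 25))
      (≤-reflexive (sym (conon+d+d u v))) (conon≤ u≢v eq) hu hv)

    low-sum : ∀ {U m} → U ⊆ L → ∥ U ∥ ≡ m → ∑ V (λ w → deg U w * deg U w) * 12 ≤ m * n * 12 + m * m * n
    low-sum s = clique-sum (AllPairs-map₂ low⇒12codeg≤ (All-resp-⊆ s L-low) (⊆V⇒distinct (⊆-trans s L⊆V)))

    anti : Fin n → Fin n → Bool
    anti u w = not (adj G u w) ∧ not ⌊ u ≟ w ⌋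

    anti⇒conon≤ : ∀ {u w} → anti u w ≡ true → conon u w * 2 ≤ n
    anti⇒conon≤ {u} {w} eq with adj G u w in e | u ≟ w
    ... | false | no u≢w = conon≤ u≢w e

    -- From (100(x + y) − 58m)² ≥ 0.
    no-low-anti : ∀ {U W m} → 2000 ≤ m → U ⊆ L → W ⊆ L → ∥ U ∥ ≡ m → ∥ W ∥ ≡ m → All (λ u → All (λ w → anti u w ≡ true) W) U → ⊥
    no-low-anti {U} {W} {m} 2000≤m sU sW eU eW A = 1≰0 (certify
      (n ∷ m ∷ ∑ V (λ w → deg U w * deg U w) ∷ ∑ V (λ w → deg W w * deg W w) ∷ ∑ V (λ w → con U w * con W w) ∷
        ∑ V (deg U) ∷ ∑ V (deg W) ∷ ∥ V ∥ ∷ [])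
      (λ n m X Y C D E v →
        (v ⊗ (m ⊗ m · 16636) ⊑ X · 10000 ⊕ Y · 10000 ⊕ C · 20000 ⊕ D ⊗ (m · 8400) ⊕ E ⊗ (m · 8400)) ⟨ # 6 ⟩⇒
        (n ⊑ v) ⟨ m ⊗ m · 99816 ⟩⇒
        (X · 12 ⊑ m ⊗ n · 12 ⊕ m ⊗ m ⊗ n) ⟨ # 5000 ⟩⇒ (Y · 12 ⊑ m ⊗ n · 12 ⊕ m ⊗ m ⊗ n) ⟨ # 5000 ⟩⇒
        (C · 2 ⊑ m ⊗ (m ⊗ n)) ⟨ # 60000 ⟩⇒
        (D · 100 ⊑ m ⊗ (n · 29)) ⟨ m · 504 ⟩⇒ (E · 100 ⊑ m ⊗ (n · 29)) ⟨ m · 504 ⟩⇒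
        (# 2000 ⊑ m) ⟨ m ⊗ n · 584 ⟩⇒ (# 2000 ⊑ m) ⟨ n ⟩⇒ (# 1 ⊑ n) ⟨ # 1 ⟩⇒
        goal (# 1 ⊑ # 0))
      (∑-lin-≤ V [ (λ _ → 1) ∙ m * m * 16636 ]
        ([ (λ w → deg U w * deg U w) ∙ 10000 ] ⊞ (λ w → deg W w * deg W w) ∙ 10000 ⊞ (λ w → con U w * con W w) ∙ 20000
          ⊞ deg U ∙ m * 8400 ⊞ deg W ∙ m * 8400)
        (λ w → certify (deg U w ∷ deg W w ∷ con U w ∷ con W w ∷ m ∷ [])
          (λ x y x̄ ȳ m → (m ⊗ m ⊕ x ⊗ y ⊑ x̄ ⊗ ȳ ⊕ x ⊗ m ⊕ y ⊗ m) ⟨ # 20000 ⟩⇒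
            ((x ⊕ y) · 100 ⊗ (m · 58) · 2 ⊑ (x ⊕ y) · 100 ⊗ ((x ⊕ y) · 100) ⊕ m · 58 ⊗ (m · 58)) ⟨ # 1 ⟩⇒
            goal (# 1 ⊗ (m ⊗ m · 16636) ⊑ x ⊗ x · 10000 ⊕ y ⊗ y · 10000 ⊕ x̄ ⊗ ȳ · 20000 ⊕ x ⊗ (m · 8400) ⊕ y ⊗ (m · 8400)))
          (complement-product (deg U w) (con U w) (deg W w) (con W w) (trans (deg+con U w) eU) (trans (deg+con W w) eW))
          (2ab≤a²+b² ((deg U w + deg W w) * 100) (m * 58))))
      (≤-reflexive (sym ∥V∥≡n)) (low-sum sU eU) (low-sum sW eW)
      (subst₂ (λ a b → ∑ V (λ w → con U w * con W w) * 2 ≤ a * (b * n)) eU eW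
        (∑-cross V β β 2 n (All.map (All.map anti⇒conon≤) A)))
      (degrees sU eU) (degrees sW eW) 2000≤m 2000≤m 1≤n)
      where
      degrees : ∀ {U} → U ⊆ L → ∥ U ∥ ≡ m → ∑ V (deg U) * 100 ≤ m * (n * 29)
      degrees {U} s refl = ≤-trans (≤-reflexive (trans (cong (_* 100) (∑-deg U)) (sym (∑-* U d 100)))) (∑-bound (All-resp-⊆ s L-low))

    α-sym : ∀ u w → α u w ≡ α w u
    α-sym u w = cong ind (adj-sym G u w)

    -- If `4 m₀` vertices of `L` were adjacent to less than half of `L`, averaging and `common`
    -- would yield two sets of size m₀ in `L` without edges between them, against `no-low-anti`. The
    -- other vertices have at least `∥ L ∥ / 2` neighbours each, and `12 m₀ ≤ ∥ L ∥` leaves a total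
    -- of a third of the square.
    low-internal-degrees : 2 ^ (m₀ * 4) * m₀ * 4 ≤ ∥ L ∥ → m₀ * 12 ≤ ∥ L ∥ → ∥ L ∥ * ∥ L ∥ ≤ ∑ L (deg L) * 3
    low-internal-degrees big 12m₀≤ = *-cancelʳ-≤ (∥ L ∥ * ∥ L ∥) (∑ L (deg L) * 3) 2 (certify
      (∥ L ∥ ∷ ∑ L (deg L) ∷ ∑ L (ind ∘ sparse) ∷ m₀ ∷ [])
      (λ l s q m → (l ⊗ l ⊑ s · 2 ⊕ q ⊗ l) ⟨ # 3 ⟩⇒ (# 1 ⊕ q ⊑ m · 4) ⟨ l · 3 ⟩⇒ (m · 12 ⊑ l) ⟨ l ⟩⇒
        goal (l ⊗ l · 2 ⊑ s · 3 · 2))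
      (∑-lin-≤ L [ (λ _ → 1) ∙ ∥ L ∥ ] ([ deg L ∙ 2 ] ⊞ ind ∘ sparse ∙ ∥ L ∥) pointwise)
      (≤-trans (s≤s (≤-reflexive (∑-ind sparse L))) (≰⇒> few)) 12m₀≤)
      where
      sparse : Fin n → Bool
      sparse u = deg L u * 2 <ᵇ ∥ L ∥

      Q : List (Fin n)
      Q = filterᵇ sparse L

      pointwise : ∀ u → 1 * ∥ L ∥ ≤ deg L u * 2 + ind (sparse u) * ∥ L ∥
      pointwise u with sparse u in eq
      ... | true  = m≤n+m _ (deg L u * 2)
      ... | false = ≤-trans (≤-reflexive (+-identityʳ _)) (≤-trans (<ᵇ-false eq) (m≤m+n _ 0))

      antis : Fin n → ℕ
      antis q = ∑ L (ind ∘ anti q)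

      cover : ∀ q → ∥ L ∥ ≤ antis q + deg L q + 1
      cover q = ≤-trans (≤-trans (∑-mono (All.universal one L))
        (≤-reflexive (trans (∑-+ L (λ w → ind (anti q w) + α w q) _) (cong (_+ ∑ L (λ w → ind ⌊ q ≟ w ⌋)) (∑-+ L (ind ∘ anti q) (λ w → α w q))))))
        (+-monoʳ-≤ (antis q + deg L q) (∑-eq≤1 q (⊆V⇒distinct L⊆V)))
        where
        one : ∀ w → 1 ≤ ind (anti q w) + α w q + ind ⌊ q ≟ w ⌋
        one w rewrite adj-sym G w q with adj G q w | q ≟ w
        ... | true  | _     = s≤s z≤n
        ... | false | yes _ = s≤s z≤n
        ... | false | no _  = s≤s z≤n

      spread : ∀ qs → qs ⊆ Q → ∥ qs ∥ ≡ m₀ * 4 → ⊥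
      spread qs sq eq =
        let U , ys , sU , eU , sY , m₀≤ , A = common anti m₀ qs many m₀ (≤-trans (s≤s z≤n) 2000≤m₀)
              (subst (λ a → 2 ^ a * m₀ ≤ ∥ many ∥) (sym eq) enough) (All.map (λ e → s≤s⁻¹ (<ᵇ-true e)) (all-filterᵇ _ L))
            W , sW , eW = choose m₀ ys m₀≤
        in no-low-anti 2000≤m₀ (⊆-trans sU (⊆-trans sq (filterᵇ-⊆ sparse L)))
             (⊆-trans sW (⊆-trans sY (filterᵇ-⊆ _ L))) eU eW (All.map (All-resp-⊆ sW) A)
        where
        Y : ℕ
        -- The number of vertices from which `common` extracts m₀, given `4 m₀` sparse ones.
        Y = 2 ^ (m₀ * 4) * m₀
        many : List (Fin n)
        many = filterᵇ (λ x → m₀ <ᵇ suc (∑ qs (λ q → ind (anti q x)))) L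
        S : ℕ
        S = ∑ L (λ w → ∑ qs (λ q → ind (anti q w)))
        sums : ∥ qs ∥ * ∥ L ∥ ≤ S * 2 + ∥ qs ∥ * 1
        sums = ≤-trans (∑-bound′ {f = at ([ antis ∙ 2 ] ⊞ (λ _ → 1) ∙ 1)} (All.map each (All-resp-⊆ sq (all-filterᵇ sparse L))))
          (≤-reflexive (trans (∑-lin qs ([ antis ∙ 2 ] ⊞ (λ _ → 1) ∙ 1))
            (cong (λ a → a * 2 + ∥ qs ∥ * 1) (∑-swap qs L (λ q w → ind (anti q w))))))
          where
          each : ∀ {q} → sparse q ≡ true → ∥ L ∥ ≤ antis q * 2 + 1 * 1
          each {q} e = certify (∥ L ∥ ∷ antis q ∷ deg L q ∷ [])
            (λ l a x → (l ⊑ a ⊕ x ⊕ # 1) ⟨ # 2 ⟩⇒ (# 1 ⊕ x · 2 ⊑ l) ⟨ # 1 ⟩⇒ goal (l ⊑ a · 2 ⊕ # 1 ⊗ # 1))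
            (cover q) (<ᵇ-true e)
        enough : Y ≤ ∥ many ∥
        -- The `4 m₀` sparse vertices have together about `2 m₀ ∥ L ∥` non-neighbours in `L`.
        -- Unpopular vertices absorb at most `m₀ ∥ L ∥` of these, a popular one at most `4 m₀`, so
        -- about `∥ L ∥ / 4` vertices are popular.
        enough = ≮⇒≥ (λ lt → 1≰0 (certify (∥ L ∥ ∷ S ∷ ∥ qs ∥ ∷ m₀ ∷ Y ∷ ∥ many ∥ ∷ [])
          (λ l s q m y t → (q ⊗ l ⊑ s · 2 ⊕ q ⊗ # 1) ⟨ # 1 ⟩⇒ (s ⊑ t ⊗ q ⊕ l ⊗ m) ⟨ # 2 ⟩⇒
            (q ⊑ m · 4) ⟨ t · 2 ⊕ # 1 ⟩⇒ (m · 4 ⊑ q) ⟨ l ⟩⇒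
            (# 1 ⊕ t ⊑ y) ⟨ m · 8 ⟩⇒ (y · 4 ⊑ l) ⟨ m · 2 ⟩⇒ (# 2000 ⊑ m) ⟨ # 1 ⟩⇒ goal (# 1 ⊑ # 0))
          sums (popular anti m₀ qs L) (≤-reflexive eq) (≤-reflexive (sym eq)) lt big 2000≤m₀))

      few : ¬ (m₀ * 4 ≤ ∥ Q ∥)
      few h = let qs , sq , eq = choose (m₀ * 4) Q h in spread qs sq eq

    -- By `low-sum` the mean density towards `L` over all vertices is at most about 1/√12 < 0.2887;
    -- on `L` itself it is at least 1/3, so on `M` it is below 0.289 < 1 - 1/√2. The same facts give
    -- ∥ L ∥ < 0.867 n, hence the bound on `∥ M ∥`. The size of `L` absorbs the diagonal of the Gram
    -- bound.
    average : 360000 ≤ ∥ L ∥ → ∥ L ∥ * ∥ L ∥ ≤ ∑ L (deg L) * 3 →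
      n ≤ ∥ M ∥ * 10 × ∑ M (deg L) * 1000 ≤ ∥ L ∥ * ∥ M ∥ * 289
    average big internal = n≤10μ , *-cancelʳ-≤ _ _ 348 (certify (n ∷ λL ∷ μ ∷ σL ∷ σM ∷ σ ∷ [])
      (λ n l μ σL σM σ → (σM ⊕ σL ⊑ σ) ⟨ # 348000 ⟩⇒ (l ⊗ l ⊑ σL · 3) ⟨ # 116000 ⟩⇒
        (σ · 69600 ⊑ n · 120000 ⊕ l ⊗ n · 20092) ⟨ # 5 ⟩⇒ (n ⊑ l ⊕ μ) ⟨ l · 100460 ⟩⇒ (n ⊑ μ · 10) ⟨ # 600000 ⟩⇒
        (# 360000 ⊑ l) ⟨ μ · 112 ⟩⇒ goal (σM · 1000 · 348 ⊑ l ⊗ μ · 289 · 348))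
      (≤-reflexive (trans (+-comm σM σL) split)) internal σ≤ (≤-reflexive (sym ∥L∥+∥M∥≡n)) n≤10μ big)
      where
      λL μ σL σM σ : ℕ
      λL = ∥ L ∥
      μ  = ∥ M ∥
      σL = ∑ L (deg L)
      σM = ∑ M (deg L)
      σ  = ∑ V (deg L)
      instance
        nonZero : NonZero λL
        nonZero = >-nonZero (≤-trans (s≤s z≤n) big)
      split : σL + σM ≡ σ
      split = ∑-split low V (deg L)
      σ≤ : σ * 69600 ≤ n * 120000 + λL * n * 20092
      σ≤ = *-cancelˡ-≤ λL (certify (n ∷ λL ∷ ∑ V (λ w → deg L w * deg L w) ∷ σ ∷ [])
        (λ n m X D → (X · 12 ⊑ m ⊗ n · 12 ⊕ m ⊗ m ⊗ n) ⟨ # 10000 ⟩⇒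
          (D ⊗ (m · 5800) ⊑ X · 10000 ⊕ n ⊗ (m ⊗ m · 841)) ⟨ # 12 ⟩⇒
          goal (m ⊗ (D · 69600) ⊑ m ⊗ (n · 120000 ⊕ m ⊗ n · 20092)))
        (low-sum ⊆-refl refl) (deg-square-sum L λL))
      λ≤ : λL * 69600 ≤ n * 60277
      λ≤ = *-cancelˡ-≤ λL (certify (n ∷ λL ∷ σL ∷ σ ∷ [])
        (λ n l s t → (l ⊗ l ⊑ s · 3) ⟨ # 69600 ⟩⇒ (s ⊑ t) ⟨ # 208800 ⟩⇒ (t · 69600 ⊑ n · 120000 ⊕ l ⊗ n · 20092) ⟨ # 3 ⟩⇒
          (# 360000 ⊑ l) ⟨ n ⟩⇒ goal (l ⊗ (l · 69600) ⊑ l ⊗ (n · 60277)))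
        internal (≤-trans (m≤m+n σL σM) (≤-reflexive split)) σ≤ big)
      n≤10μ : n ≤ μ * 10
      n≤10μ = *-cancelʳ-≤ _ _ 9323 (certify (n ∷ λL ∷ μ ∷ [])
        (λ n l μ → (l · 69600 ⊑ n · 60277) ⟨ # 1 ⟩⇒ (n ⊑ l ⊕ μ) ⟨ # 69600 ⟩⇒ goal (n · 9323 ⊑ μ · 10 · 9323))
        λ≤ (≤-reflexive (sym ∥L∥+∥M∥≡n)))

    -- Pairs of joined independent sets.

    con≤ : ∀ U w → con U w ≤ ∥ U ∥
    con≤ U w = ≤-trans (m≤n+m (con U w) (deg U w)) (≤-reflexive (deg+con U w))

    near-full : ∀ m k x̄ → m ≤ x̄ + k → x̄ ≤ m → m * m ≤ x̄ * x̄ + m * k * 2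
    near-full m k x̄ h₁ h₂ = certify (m ∷ k ∷ x̄ ∷ []) (λ m k x̄ →
      (m ⊑ x̄ ⊕ k) ⟨ m ⟩⇒ (m ⊑ x̄ ⊕ k) ⟨ x̄ ⟩⇒ (x̄ ⊑ m) ⟨ k ⟩⇒ goal (m ⊗ m ⊑ x̄ ⊗ x̄ ⊕ m ⊗ k · 2)) h₁ h₁ h₂

    con-full : ∀ U {m} k w → ∥ U ∥ ≡ m → deg U w ≤ k → m * m ≤ con U w * con U w + m * k * 2
    con-full U k w refl h = near-full ∥ U ∥ k (con U w)
      (≤-trans (≤-reflexive (trans (sym (deg+con U w)) (+-comm (deg U w) _))) (+-monoʳ-≤ (con U w) h)) (con≤ U w)

    ∑-LM : ∀ f → ∑ L f + ∑ M f ≡ ∑ V f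
    ∑-LM = ∑-split low V

    con-low-sum : ∀ {U m} t → ∥ U ∥ ≡ m → All (λ u → deg L u ≤ t) U → m * ∥ L ∥ ≤ ∑ L (con U) + m * t
    con-low-sum {U} t refl h = certify (∥ U ∥ ∷ ∥ L ∥ ∷ ∑ L (deg U) ∷ ∑ L (con U) ∷ t ∷ [])
      (λ m l D C t → (l ⊗ m ⊑ D ⊕ C) ⟨ # 1 ⟩⇒ (D ⊑ m ⊗ t) ⟨ # 1 ⟩⇒ goal (m ⊗ l ⊑ C ⊕ m ⊗ t))
      (≤-trans (∑-bound′ (All.universal (λ w → ≤-reflexive (sym (deg+con U w))) L)) (≤-reflexive (∑-+ L (deg U) (con U))))
      (≤-trans (≤-reflexive (trans (∑-swap L U (λ w u → α u w)) (∑-cong U (λ u → ∑-cong L (λ w → α-sym u w))))) (∑-bound h))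

    -- From (100x̄ − 71m)² ≥ 0.
    con-low-square-sum : ∀ U m → ∑ L (con U) * (m * 14200) ≤ ∑ L (λ w → con U w * con U w) * 10000 + ∥ L ∥ * (m * m * 5041)
    con-low-square-sum U m = ∑-lin-≤ L [ con U ∙ m * 14200 ] ([ (λ w → con U w * con U w) ∙ 10000 ] ⊞ (λ _ → 1) ∙ m * m * 5041)
      (λ w → certify (con U w ∷ m ∷ []) (λ x m → (x · 100 ⊗ (m · 71) · 2 ⊑ x · 100 ⊗ (x · 100) ⊕ m · 71 ⊗ (m · 71)) ⟨ # 1 ⟩⇒
        goal (x ⊗ (m · 14200) ⊑ x ⊗ x · 10000 ⊕ # 1 ⊗ (m ⊗ m · 5041))) (2ab≤a²+b² (con U w * 100) (m * 71)))

    rich : ℕ → List (Fin n) → Fin n → Bool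
    rich m U w = m <ᵇ suc (deg U w)

    rich-true : ∀ {m U w} → rich m U w ≡ true → m ≤ deg U w
    rich-true e = s≤s⁻¹ (<ᵇ-true e)

    rich-false : ∀ {m} U {w} → rich m U w ≡ false → deg U w ≤ m
    rich-false U e = ≤-trans (n≤1+n _) (<ᵇ-false e)

    -- At most m neighbours in U force `x̄² ≥ T² − 2Tm`; rich vertices are charged the whole `T²`.
    rich-sum : ∀ xs U {T} m → ∥ U ∥ ≡ T → ∥ xs ∥ * (T * T) ≤
      ∑ xs (λ w → con U w * con U w) * 1 + ∥ xs ∥ * (T * m * 2) + ∑ xs (ind ∘ rich m U) * (T * T)
    rich-sum xs U {T} m eq = ∑-lin-≤ xs [ (λ _ → 1) ∙ T * T ]
      ([ (λ w → con U w * con U w) ∙ 1 ] ⊞ (λ _ → 1) ∙ T * m * 2 ⊞ ind ∘ rich m U ∙ T * T) pointwise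
      where
      pointwise : ∀ w → 1 * (T * T) ≤ con U w * con U w * 1 + 1 * (T * m * 2) + ind (rich m U w) * (T * T)
      pointwise w with rich m U w in e
      ... | true  = m≤n+m _ (con U w * con U w * 1 + 1 * (T * m * 2))
      ... | false = certify (T ∷ con U w ∷ m ∷ []) (λ T x m → (T ⊗ T ⊑ x ⊗ x ⊕ T ⊗ m · 2) ⟨ # 1 ⟩⇒
        goal (# 1 ⊗ (T ⊗ T) ⊑ x ⊗ x · 1 ⊕ # 1 ⊗ (T ⊗ m · 2) ⊕ # 0)) (con-full U m w eq (rich-false U e))

    record Pair (m : ℕ) : Set where
      constructor mkPair
      field
        {U W}   : List (Fin n)
        U⊆M    : U ⊆ M
        W⊆M    : W ⊆ M
        ∥U∥≡m  : ∥ U ∥ ≡ m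
        ∥W∥≡m  : ∥ W ∥ ≡ m
        indep-U : Indep U
        indep-W : Indep W
        joined  : Joined U W

    swap : ∀ {m} → Pair m → Pair m
    swap (mkPair sU sW eU eW iU iW J) = mkPair sW sU eW eU iW iU (Joined-sym J)

    -- `common` shrinks U to m vertices with many common neighbours in P, and Ramsey's theorem among
    -- these neighbours supplies W.
    extend : ∀ {U P T₀ m} → U ⊆ M → ∥ U ∥ ≡ T₀ → Indep U → P ⊆ M → All (λ w → m ≤ deg U w) P →
      2 ^ T₀ * suc (ram m₀ m) ≤ ∥ P ∥ → Σ (Pair m) λ 𝒫 → Pair.U 𝒫 ⊆ U × Pair.W 𝒫 ⊆ P
    extend {U} {P} {T₀} {m} sU refl iU sP big h =
      let U′ , Y , sU′ , eU , sY , r≤ , A = common (adj G) m U P (suc (ram m₀ m)) (s≤s z≤n) h big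
          W , sW , eW , iW = independent-subset m (⊆-trans sY sP) (≤-trans (n≤1+n _) r≤)
      in mkPair (⊆-trans sU′ sU) (⊆-trans sW (⊆-trans sY sP)) eU eW (AllPairs-⊆ sU′ iU) iW
           (All.map (All-resp-⊆ sW) A) , sU′ , ⊆-trans sW sY

    module _ {m : ℕ} (𝒫 : Pair m) where
      open Pair 𝒫

      shared : ℕ → Fin n → Bool
      shared k w = rich k U w ∧ rich k W w

      -- Otherwise `common`, applied to U and then to W, leaves k-subsets of both with enough common
      -- neighbours for an independent k-set, against `no-triple`. Each application costs a factor
      -- `2 ^ m`.
      few-shared : ∀ {k} → K * 6 < k → ∑ M (ind ∘ shared k) < 2 ^ m * (2 ^ m * suc (ram m₀ k))
      few-shared {k} 6K<k = ≤-trans (s≤s (≤-reflexive (∑-ind (shared k) M))) (≰⇒> impossible)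
        where
        Z : List (Fin n)
        Z = filterᵇ (shared k) M
        r : ℕ
        r = suc (ram m₀ k)
        impossible : ¬ (2 ^ m * (2 ^ m * r) ≤ ∥ Z ∥)
        impossible h =
          let U′ , Z₁ , sU′ , eU , sZ₁ , r≤₁ , A₁ = common (adj G) k U Z (2 ^ m * r) (*-mono-≤ (m^n>0 2 m) (s≤s z≤n))
                (subst (λ a → 2 ^ a * (2 ^ m * r) ≤ ∥ Z ∥) (sym ∥U∥≡m) h)
                (All.map (λ e → rich-true {U = U} (proj₁ (∧-true e))) (all-filterᵇ (shared k) M))
              W′ , Z₂ , sW′ , eW , sZ₂ , r≤₂ , A₂ = common (adj G) k W Z₁ r (s≤s z≤n)
                (subst (λ a → 2 ^ a * r ≤ ∥ Z₁ ∥) (sym ∥W∥≡m) r≤₁)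
                (All-resp-⊆ sZ₁ (All.map (λ e → rich-true {U = W} (proj₂ (∧-true {a = rich k U _} e))) (all-filterᵇ (shared k) M)))
              I , sI , eI , iI = independent-subset k (⊆-trans sZ₂ (⊆-trans sZ₁ (filterᵇ-⊆ (shared k) M))) (≤-trans (n≤1+n _) r≤₂)
          in no-triple 6K<k (AllPairs-⊆ sU′ indep-U) (AllPairs-⊆ sW′ indep-W) iI eU eW eI
               (All.map (All-resp-⊆ sW′) (All-resp-⊆ sU′ joined))
               (All.map (All-resp-⊆ (⊆-trans sI sZ₂)) A₁) (All.map (All-resp-⊆ sI) A₂)

      not-shared : ∀ {k w} → shared k w ≡ false → deg U w ≤ k ⊎ deg W w ≤ k
      not-shared {k} {w} e with rich k U w in eU
      ... | false = inj₁ (rich-false U eU)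
      ... | true  = inj₂ (rich-false W e)

      -- A vertex that is not shared has at most k neighbours in U or in W, so one of its two
      -- squares is at least `m² − 2mk`.
      pair-sum : ∀ k → ∥ M ∥ * (m * m) ≤ ∑ M (λ w → con U w * con U w) * 1 + ∑ M (λ w → con W w * con W w) * 1
        + ∥ M ∥ * (m * k * 2) + ∑ M (ind ∘ shared k) * (m * m)
      pair-sum k = ∑-lin-≤ M [ (λ _ → 1) ∙ m * m ] ([ (λ w → con U w * con U w) ∙ 1 ] ⊞ (λ w → con W w * con W w) ∙ 1
          ⊞ (λ _ → 1) ∙ m * k * 2 ⊞ ind ∘ shared k ∙ m * m) pointwise
        where
        pointwise : ∀ w → 1 * (m * m) ≤ con U w * con U w * 1 + con W w * con W w * 1 + 1 * (m * k * 2) + ind (shared k w) * (m * m)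
        pointwise w with shared k w in e
        ... | true  = m≤n+m _ (con U w * con U w * 1 + con W w * con W w * 1 + 1 * (m * k * 2))
        ... | false with not-shared {k} e
        ...   | inj₁ h = certify (m ∷ con U w ∷ con W w ∷ k ∷ []) (λ m x y k → (m ⊗ m ⊑ x ⊗ x ⊕ m ⊗ k · 2) ⟨ # 1 ⟩⇒
                  goal (# 1 ⊗ (m ⊗ m) ⊑ x ⊗ x · 1 ⊕ y ⊗ y · 1 ⊕ # 1 ⊗ (m ⊗ k · 2) ⊕ # 0)) (con-full U k w ∥U∥≡m h)
        ...   | inj₂ h = certify (m ∷ con U w ∷ con W w ∷ k ∷ []) (λ m x y k → (m ⊗ m ⊑ y ⊗ y ⊕ m ⊗ k · 2) ⟨ # 1 ⟩⇒
                  goal (# 1 ⊗ (m ⊗ m) ⊑ x ⊗ x · 1 ⊕ y ⊗ y · 1 ⊕ # 1 ⊗ (m ⊗ k · 2) ⊕ # 0)) (con-full W k w ∥W∥≡m h)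

    -- The set of low-degree vertices is small.

    quantile-sum : ∀ (f : Fin n → ℕ) t xs → ∥ xs ∥ * t ≤ ∑ xs f * 1 + ∑ xs (λ x → ind (f x <ᵇ t)) * t
    quantile-sum f t xs = ∑-lin-≤ xs [ (λ _ → 1) ∙ t ] ([ f ∙ 1 ] ⊞ (λ x → ind (f x <ᵇ t)) ∙ t) pointwise
      where
      pointwise : ∀ x → 1 * t ≤ f x * 1 + ind (f x <ᵇ t) * t
      pointwise x with f x <ᵇ t in e
      ... | true  = m≤n+m _ (f x * 1)
      ... | false = certify (t ∷ f x ∷ []) (λ t x → (t ⊑ x) ⟨ # 1 ⟩⇒ goal (# 1 ⊗ t ⊑ x · 1 ⊕ # 0)) (<ᵇ-false e)

    ind-mono : ∀ x {a b} → a ≤ b → ind (x <ᵇ a) ≤ ind (x <ᵇ b)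
    ind-mono x {a} {b} a≤b with x <ᵇ a in e₁ | x <ᵇ b in e₂
    ... | false | _     = z≤n
    ... | true  | true  = ≤-refl
    ... | true  | false = contradiction (≤-trans (<ᵇ-true e₁) a≤b) (≤⇒≯ (<ᵇ-false e₂))

    n≤λ+μ : n ≤ ∥ L ∥ + ∥ M ∥
    n≤λ+μ = ≤-reflexive (sym ∥L∥+∥M∥≡n)

    sq : List (Fin n) → Fin n → ℕ
    sq U w = con U w * con U w

    -- On `L` the mean of 1 - x is at least 0.71, so ∫(1 - x)² there is at least 0.5041, more than
    -- the share of `L` in `row`. What remains for `M` is about a half, and each vertex that is not
    -- rich uses almost 1 of it.
    rich-many : ∀ {U T m t} → n ≤ ∥ M ∥ * 10 → (m * 4 + 20) * 1000 ≤ T → t * 100 ≤ ∥ L ∥ * 29 →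
      ∥ U ∥ ≡ T → Indep U → All (λ u → deg L u ≤ t) U → ∥ M ∥ * 4995 ≤ ∥ filterᵇ (rich m U) M ∥ * 10000
    rich-many {U} {T} {m} {t} n≤10μ T-big t≤ eq I poor =
      *-cancelˡ-≤ T {{T≢0}} (*-cancelˡ-≤ T {{T≢0}} (certify
        (n ∷ ∥ L ∥ ∷ ∥ M ∥ ∷ T ∷ m ∷ t ∷ ∑ V (sq U) ∷ ∑ L (sq U) ∷ ∑ M (sq U) ∷ ∑ L (con U) ∷
          ∑ M (ind ∘ rich m U) ∷ ∥ filterᵇ (rich m U) M ∥ ∷ [])
        (λ n l μ T m t X XL XM C s s′ →
          (X · 2 ⊑ T ⊗ n · 2 ⊕ T ⊗ T ⊗ n) ⟨ # 5000 ⟩⇒ (XL ⊕ XM ⊑ X) ⟨ # 10000 ⟩⇒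
          (C ⊗ (T · 14200) ⊑ XL · 10000 ⊕ l ⊗ (T ⊗ T · 5041)) ⟨ # 1 ⟩⇒
          (T ⊗ l ⊑ C ⊕ T ⊗ t) ⟨ T · 14200 ⟩⇒ (t · 100 ⊑ l · 29) ⟨ T ⊗ T · 142 ⟩⇒
          (μ ⊗ (T ⊗ T) ⊑ XM · 1 ⊕ μ ⊗ (T ⊗ m · 2) ⊕ s ⊗ (T ⊗ T)) ⟨ # 10000 ⟩⇒ (s ⊑ s′) ⟨ T ⊗ T · 10000 ⟩⇒
          (n ⊑ l ⊕ μ) ⟨ T ⊗ T · 5000 ⟩⇒ (n ⊑ μ · 10) ⟨ T · 10000 ⟩⇒ ((m · 4 ⊕ # 20) · 1000 ⊑ T) ⟨ μ ⊗ T · 5 ⟩⇒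
          goal (T ⊗ (T ⊗ (μ · 4995)) ⊑ T ⊗ (T ⊗ (s′ · 10000))))
        (row I eq) (≤-reflexive (∑-LM (sq U))) (con-low-square-sum U T) (con-low-sum t eq poor) t≤
        (rich-sum M U m eq) (≤-reflexive (∑-ind (rich m U) M)) n≤λ+μ n≤10μ T-big))
      where
      T≢0 : NonZero T
      T≢0 = >-nonZero (certify (m ∷ T ∷ []) (λ m T → ((m · 4 ⊕ # 20) · 1000 ⊑ T) ⟨ # 1 ⟩⇒ goal (# 1 ⊑ T)) T-big)

    -- (1 − X)² + (1 − Y)² > 1 for the densities X, Y of the two sides towards L.
    poor-pair : ∀ {k m s t Θ} (𝒫 : Pair m) → K * 6 < k → Θ * (k + 1) * 500 < m →
      Θ * (2 ^ m * (2 ^ m * suc (ram m₀ k))) * 250 ≤ n → (s + t) * 100 ≤ ∥ L ∥ * 58 →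
      All (λ u → deg L u ≤ t) (Pair.U 𝒫) → All (λ u → deg L u ≤ s) (Pair.W 𝒫) → ¬ (n ≤ ∥ L ∥ * Θ)
    poor-pair {k} {m} {s} {t} {Θ} 𝒫 6K<k m-big n-big s+t≤ pU pW n≤ = 1≰0 (certify (Θ ∷ k ∷ m ∷ n ∷ ∥ L ∥ ∷ z ∷ c ∷ [])
      (λ Θ k m n l z c → (m ⊗ l · 82 ⊑ n · 20000 ⊕ n ⊗ k · 20000 ⊕ z ⊗ m · 10000) ⟨ Θ ⟩⇒ (n ⊑ l ⊗ Θ) ⟨ m · 82 ⟩⇒
        (# 1 ⊕ Θ ⊗ (k ⊕ # 1) · 500 ⊑ m) ⟨ n · 41 ⟩⇒ (# 1 ⊕ z ⊑ c) ⟨ Θ ⊗ m · 10250 ⟩⇒ (Θ ⊗ c · 250 ⊑ n) ⟨ m · 41 ⟩⇒ (# 1 ⊑ n) ⟨ # 41 ⟩⇒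
        goal (# 1 ⊑ # 0))
      (*-cancelˡ-≤ m {{>-nonZero (≤-trans (s≤s z≤n) m-big)}} (certify
        (n ∷ ∥ L ∥ ∷ ∥ M ∥ ∷ m ∷ k ∷ s ∷ t ∷ z ∷ ∑ V (sq U) ∷ ∑ L (sq U) ∷ ∑ M (sq U) ∷ ∑ L (con U) ∷
          ∑ V (sq W) ∷ ∑ L (sq W) ∷ ∑ M (sq W) ∷ ∑ L (con W) ∷ [])
        (λ n l μ m k s t z X XL XM C Y YL YM D →
          (X · 2 ⊑ m ⊗ n · 2 ⊕ m ⊗ m ⊗ n) ⟨ # 5000 ⟩⇒ (Y · 2 ⊑ m ⊗ n · 2 ⊕ m ⊗ m ⊗ n) ⟨ # 5000 ⟩⇒
          (XL ⊕ XM ⊑ X) ⟨ # 10000 ⟩⇒ (YL ⊕ YM ⊑ Y) ⟨ # 10000 ⟩⇒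
          (C ⊗ (m · 14200) ⊑ XL · 10000 ⊕ l ⊗ (m ⊗ m · 5041)) ⟨ # 1 ⟩⇒
          (D ⊗ (m · 14200) ⊑ YL · 10000 ⊕ l ⊗ (m ⊗ m · 5041)) ⟨ # 1 ⟩⇒
          (m ⊗ l ⊑ C ⊕ m ⊗ t) ⟨ m · 14200 ⟩⇒ (m ⊗ l ⊑ D ⊕ m ⊗ s) ⟨ m · 14200 ⟩⇒
          ((s ⊕ t) · 100 ⊑ l · 58) ⟨ m ⊗ m · 142 ⟩⇒
          (μ ⊗ (m ⊗ m) ⊑ XM · 1 ⊕ YM · 1 ⊕ μ ⊗ (m ⊗ k · 2) ⊕ z ⊗ (m ⊗ m)) ⟨ # 10000 ⟩⇒
          (n ⊑ l ⊕ μ) ⟨ m ⊗ m · 10000 ⟩⇒ (l ⊕ μ ⊑ n) ⟨ m ⊗ k · 20000 ⟩⇒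
          goal (m ⊗ (m ⊗ l · 82) ⊑ m ⊗ (n · 20000 ⊕ n ⊗ k · 20000 ⊕ z ⊗ m · 10000)))
        (row indep-U ∥U∥≡m) (row indep-W ∥W∥≡m) (≤-reflexive (∑-LM (sq U))) (≤-reflexive (∑-LM (sq W)))
        (con-low-square-sum U m) (con-low-square-sum W m) (con-low-sum t ∥U∥≡m pU) (con-low-sum s ∥W∥≡m pW)
        s+t≤ (pair-sum 𝒫 k) n≤λ+μ (≤-reflexive ∥L∥+∥M∥≡n)))
      n≤ m-big (few-shared 𝒫 6K<k) n-big 1≤n)
      where
      open Pair 𝒫
      z c : ℕ
      z = ∑ M (ind ∘ shared 𝒫 k)
      c = 2 ^ m * (2 ^ m * suc (ram m₀ k))

    module _ {R : ℕ} (1≤R : 1 ≤ R) (2000R≤μ : R * 2000 ≤ ∥ M ∥) (avg : ∑ M (deg L) * 1000 ≤ ∥ L ∥ * ∥ M ∥ * 289) where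

      μ-nonZero : NonZero ∥ M ∥
      μ-nonZero = >-nonZero (≤-trans 1≤R (≤-trans (m≤m*n R 2000) 2000R≤μ))

      -- Markov's inequality for a mean of at most 0.289 ∥ L ∥; the gap to 0.29 absorbs the fewer
      -- than R exceptions.
      quantile-M≤ : ∀ t → ∑ M (λ x → ind (deg L x <ᵇ t)) < R → t * 100 ≤ ∥ L ∥ * 29
      quantile-M≤ t exceptions = *-cancelʳ-≤ _ _ 999 (certify (t ∷ ∥ L ∥ ∷ [])
        (λ t l → (t · 999 ⊑ l · 289) ⟨ # 100 ⟩⇒ goal (t · 100 · 999 ⊑ l · 29 · 999))
        (*-cancelˡ-≤ ∥ M ∥ {{μ-nonZero}} (certify (∥ M ∥ ∷ t ∷ ∥ L ∥ ∷ ∑ M (deg L) ∷ ∑ M (λ x → ind (deg L x <ᵇ t)) ∷ R ∷ [])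
          (λ μ t l σ q r → (μ ⊗ t ⊑ σ · 1 ⊕ q ⊗ t) ⟨ # 1000 ⟩⇒ (σ · 1000 ⊑ l ⊗ μ · 289) ⟨ # 1 ⟩⇒ (# 1 ⊕ q ⊑ r) ⟨ t · 2000 ⟩⇒
            (r · 2000 ⊑ μ) ⟨ t ⟩⇒ goal (μ ⊗ (t · 999) ⊑ μ ⊗ (l · 289)))
          (quantile-sum (deg L) t M) avg exceptions 2000R≤μ)))

      -- Almost all degrees are at least t + e on a part of nearly half of `M` or more, and at least
      -- t elsewhere, so the mean is at least about t + e/2. This is half the sum of the two
      -- quantiles. Since e ≥ 0, a lower bound on the size of the part suffices.
      quantiles≤ : ∀ (S : Fin n → Bool) t e → ∥ M ∥ * 4995 ≤ ∥ filterᵇ S M ∥ * 10000 →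
        ∑ M (λ x → ind (deg L x <ᵇ t)) < R → ∑ (filterᵇ S M) (λ x → ind (deg L x <ᵇ t + e)) < R →
        (t + e + t) * 100 ≤ ∥ L ∥ * 58
      quantiles≤ S t e S-size exc₁ exc₂ = *-cancelʳ-≤ _ _ 499 (certify (e ∷ t ∷ ∥ L ∥ ∷ [])
        (λ e t l → ((t ⊕ e ⊕ t) · 499 ⊑ l · 289) ⟨ # 100 ⟩⇒ goal ((t ⊕ e ⊕ t) · 100 · 499 ⊑ l · 58 · 499))
        (*-cancelˡ-≤ ∥ M ∥ {{μ-nonZero}} (*-cancelʳ-≤ _ _ 10 (certify
          (∥ M ∥ ∷ t ∷ e ∷ ∥ L ∥ ∷ ∑ M (deg L) ∷ ∑ S₁ (deg L) ∷ ∑ S₂ (deg L) ∷ ∥ S₁ ∥ ∷ ∥ S₂ ∥ ∷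
            ∑ S₁ (λ x → ind (deg L x <ᵇ t + e)) ∷ ∑ S₂ (λ x → ind (deg L x <ᵇ t)) ∷ R ∷ [])
          (λ μ t e l σ a b x y p q r →
            (x ⊗ (t ⊕ e) ⊑ a · 1 ⊕ p ⊗ (t ⊕ e)) ⟨ # 10000 ⟩⇒ (y ⊗ t ⊑ b · 1 ⊕ q ⊗ t) ⟨ # 10000 ⟩⇒
            (a ⊕ b ⊑ σ) ⟨ # 10000 ⟩⇒ (σ · 1000 ⊑ l ⊗ μ · 289) ⟨ # 10 ⟩⇒ (μ ⊑ x ⊕ y) ⟨ t · 10000 ⟩⇒
            (μ · 4995 ⊑ x · 10000) ⟨ e ⟩⇒ (# 1 ⊕ p ⊑ r) ⟨ (t ⊕ e) · 10000 ⟩⇒ (q ⊑ r) ⟨ t · 10000 ⟩⇒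
            (r · 2000 ⊑ μ) ⟨ (t ⊕ e ⊕ t) · 5 ⟩⇒ goal (μ ⊗ ((t ⊕ e ⊕ t) · 499) · 10 ⊑ μ ⊗ (l · 289) · 10))
          (quantile-sum (deg L) (t + e) S₁) (quantile-sum (deg L) t S₂) (≤-reflexive (∑-split S M (deg L))) avg
          (≤-reflexive (sym (∑-split S M (λ _ → 1)))) S-size exc₂
          (≤-trans (∑-⊆ (λ x → ind (deg L x <ᵇ t)) (filterᵇ-⊆ (not ∘ S) M)) (<⇒≤ exc₁)) 2000R≤μ))))
        where
        S₁ S₂ : List (Fin n)
        S₁ = filterᵇ S M
        S₂ = filterᵇ (not ∘ S) M

    -- U is drawn from the vertices of `M` up to the R-th smallest degree towards `L`, and W
    -- likewise from those rich to U. By `quantiles≤` the two densities towards `L` add up to at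
    -- most 0.58, as `poor-pair` demands.
    low-small : ∀ {k m T₀ Θ R} → K * 6 < k → Θ * (k + 1) * 500 < m → (m * 4 + 20) * 1000 ≤ T₀ →
      Θ * (2 ^ m * (2 ^ m * suc (ram m₀ k))) * 250 ≤ n →
      ram m₀ T₀ < R → 2 ^ T₀ * suc (ram m₀ m) ≤ R → R * 20000 ≤ n →
      360000 ≤ ∥ L ∥ → ∥ L ∥ * ∥ L ∥ ≤ ∑ L (deg L) * 3 → ¬ (n ≤ ∥ L ∥ * Θ)
    low-small {k} {m} {T₀} {Θ} {R} 6K<k m-big T₀-big n-big₁ R-big₁ R-big₂ n-big₂ λ-big internal =
      let t , t-many , t-few = quantile (deg L) R M 1≤R R≤μ
          exc = ≤-trans (s≤s (≤-reflexive (∑-ind (λ x → deg L x <ᵇ t) M))) t-few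
          U , sU , eU , iU = independent-subset T₀ (filterᵇ-⊆ _ M) (≤-trans (<⇒≤ R-big₁) t-many)
      in finish t exc U (⊆-trans sU (filterᵇ-⊆ _ M)) eU iU
           (All-resp-⊆ sU (All.map (λ e → s≤s⁻¹ (<ᵇ-true e)) (all-filterᵇ (λ x → deg L x <ᵇ suc t) M)))
      where
      avg : ∑ M (deg L) * 1000 ≤ ∥ L ∥ * ∥ M ∥ * 289
      avg = proj₂ (average λ-big internal)
      n≤10μ : n ≤ ∥ M ∥ * 10
      n≤10μ = proj₁ (average λ-big internal)
      1≤R : 1 ≤ R
      1≤R = ≤-trans (s≤s z≤n) R-big₁
      2000R≤μ : R * 2000 ≤ ∥ M ∥
      2000R≤μ = *-cancelʳ-≤ _ _ 10 (certify (R ∷ n ∷ ∥ M ∥ ∷ []) (λ r n μ → (r · 20000 ⊑ n) ⟨ # 1 ⟩⇒ (n ⊑ μ · 10) ⟨ # 1 ⟩⇒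
        goal (r · 2000 · 10 ⊑ μ · 10)) n-big₂ n≤10μ)
      R≤μ : R ≤ ∥ M ∥
      R≤μ = ≤-trans (m≤m*n R 2000) 2000R≤μ

      finish : ∀ t → ∑ M (λ x → ind (deg L x <ᵇ t)) < R → ∀ U → U ⊆ M → ∥ U ∥ ≡ T₀ → Indep U →
        All (λ u → deg L u ≤ t) U → ¬ (n ≤ ∥ L ∥ * Θ)
      finish t exc U sU eU iU pU =
        let s , s-many , s-few = quantile (deg L) R S 1≤R R≤S
            -- Fewer than R vertices of `M` lie below t, so the quantile s of the part `S` is not
            -- below t and `s ∸ t` is a true difference.
            t≤s = ≮⇒≥ {s} {t} (λ s<t → <⇒≱ exc (≤-trans s-many (≤-trans (≤-reflexive (sym (∑-ind (λ x → deg L x <ᵇ suc s) S)))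
              (≤-trans (∑-mono (All.universal (λ x → ind-mono (deg L x) s<t) S)) (∑-⊆ (λ x → ind (deg L x <ᵇ t)) (filterᵇ-⊆ (rich m U) M))))))
            s+t≤ = subst (λ s → ∑ S (λ x → ind (deg L x <ᵇ s)) < R → (s + t) * 100 ≤ ∥ L ∥ * 58) (m+[n∸m]≡n t≤s)
                     (quantiles≤ 1≤R 2000R≤μ avg (rich m U) t (s ∸ t) S-size exc)
                     (≤-trans (s≤s (≤-reflexive (∑-ind (λ x → deg L x <ᵇ s) S))) s-few)
            P⊆S = filterᵇ-⊆ (λ x → deg L x <ᵇ suc s) S
            𝒫 , U⊆ , W⊆ = extend sU eU iU (⊆-trans P⊆S (filterᵇ-⊆ (rich m U) M))
              (All-resp-⊆ P⊆S (All.map (rich-true {U = U}) (all-filterᵇ (rich m U) M))) (≤-trans R-big₂ s-many)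
        in poor-pair 𝒫 6K<k m-big n-big₁ s+t≤ (All-resp-⊆ U⊆ pU)
             (All-resp-⊆ W⊆ (All.map (λ e → s≤s⁻¹ (<ᵇ-true e)) (all-filterᵇ (λ x → deg L x <ᵇ suc s) S)))
        where
        S : List (Fin n)
        S = filterᵇ (rich m U) M
        S-size : ∥ M ∥ * 4995 ≤ ∥ S ∥ * 10000
        S-size = rich-many {m = m} n≤10μ T₀-big (quantile-M≤ 1≤R 2000R≤μ avg t exc) eU iU pU
        R≤S : R ≤ ∥ S ∥
        R≤S = *-cancelʳ-≤ _ _ 10000 (certify (R ∷ ∥ M ∥ ∷ ∥ S ∥ ∷ []) (λ r μ s → (r · 2000 ⊑ μ) ⟨ # 5 ⟩⇒ (μ · 4995 ⊑ s · 10000) ⟨ # 1 ⟩⇒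
          goal (r · 10000 ⊑ s · 10000)) 2000R≤μ S-size)

    -- The two sides of a pair.

    ∑-M≤V : ∀ f → ∑ M f ≤ ∑ V f
    ∑-M≤V f = ∑-⊆ f M⊆V

    ∥M∥≤n : ∥ M ∥ ≤ n
    ∥M∥≤n = ≤-trans (∑-M≤V _) (≤-reflexive ∥V∥≡n)

    module _ {m : ℕ} (j k : ℕ) where

      -- Vertices that behave like those of U: almost everything in W is a neighbour, almost nothing
      -- in U. The opposite side comes from `swap`.
      inside : Pair m → Fin n → Bool
      inside 𝒫 w = (con (Pair.W 𝒫) w <ᵇ suc j) ∧ (deg (Pair.U 𝒫) w <ᵇ suc k)

      side : Pair m → List (Fin n)
      side 𝒫 = filterᵇ (inside 𝒫) M

      inside-con : ∀ 𝒫 → All (λ w → con (Pair.W 𝒫) w ≤ j) (side 𝒫)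
      inside-con 𝒫 = All.map (λ e → s≤s⁻¹ (<ᵇ-true (proj₁ (∧-true e)))) (all-filterᵇ (inside 𝒫) M)

      inside-deg : ∀ 𝒫 {w} → inside 𝒫 w ≡ true → deg (Pair.U 𝒫) w ≤ k
      inside-deg 𝒫 {w} e = s≤s⁻¹ (<ᵇ-true (proj₂ (∧-true {con (Pair.W 𝒫) w <ᵇ suc j} e)))

      not-inside : ∀ 𝒫 {w} → inside 𝒫 w ≡ false → deg (Pair.U 𝒫) w ≤ k → j ≤ con (Pair.W 𝒫) w
      not-inside 𝒫 {w} e h with con (Pair.W 𝒫) w <ᵇ suc j in e₁
      ... | false = ≤-trans (n≤1+n j) (<ᵇ-false e₁)
      ... | true  = contradiction (≤-trans (s≤s h) (<ᵇ-false e)) (<-irrefl refl)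

      -- The first square already supplies `m² − 2mk`; a vertex that is not inside has at least j
      -- non-neighbours in W, which adds `j²`.
      one-side : ∀ 𝒫 w → deg (Pair.U 𝒫) w ≤ k →
        m * m + j * j ≤ con (Pair.U 𝒫) w * con (Pair.U 𝒫) w + con (Pair.W 𝒫) w * con (Pair.W 𝒫) w + m * k * 2 + ind (inside 𝒫 w) * (j * j)
      one-side 𝒫 w h with inside 𝒫 w in e
      ... | true  = certify (m ∷ j ∷ k ∷ con (Pair.U 𝒫) w ∷ con (Pair.W 𝒫) w ∷ [])
        (λ m j k x y → (m ⊗ m ⊑ x ⊗ x ⊕ m ⊗ k · 2) ⟨ # 1 ⟩⇒
          goal (m ⊗ m ⊕ j ⊗ j ⊑ x ⊗ x ⊕ y ⊗ y ⊕ m ⊗ k · 2 ⊕ # 1 ⊗ (j ⊗ j)))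
        (con-full (Pair.U 𝒫) k w (Pair.∥U∥≡m 𝒫) h)
      ... | false = certify (m ∷ j ∷ k ∷ con (Pair.U 𝒫) w ∷ con (Pair.W 𝒫) w ∷ [])
        (λ m j k x y → (m ⊗ m ⊑ x ⊗ x ⊕ m ⊗ k · 2) ⟨ # 1 ⟩⇒ (j ⊑ y) ⟨ j ⟩⇒ (j ⊑ y) ⟨ y ⟩⇒
          goal (m ⊗ m ⊕ j ⊗ j ⊑ x ⊗ x ⊕ y ⊗ y ⊕ m ⊗ k · 2 ⊕ # 0))
        (con-full (Pair.U 𝒫) k w (Pair.∥U∥≡m 𝒫) h) (not-inside 𝒫 e h) (not-inside 𝒫 e h)

      sides-cover : ∀ 𝒫 → ∥ M ∥ * (m * m + j * j) ≤ ∑ M (sq (Pair.U 𝒫)) * 1 + ∑ M (sq (Pair.W 𝒫)) * 1 + ∥ M ∥ * (m * k * 2)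
        + ∑ M (ind ∘ shared 𝒫 k) * (m * m + j * j) + ∑ M (ind ∘ inside 𝒫) * (j * j) + ∑ M (ind ∘ inside (swap 𝒫)) * (j * j)
      sides-cover 𝒫 = ∑-lin-≤ M [ (λ _ → 1) ∙ m * m + j * j ] ([ sq U ∙ 1 ] ⊞ sq W ∙ 1 ⊞ (λ _ → 1) ∙ m * k * 2
          ⊞ ind ∘ shared 𝒫 k ∙ m * m + j * j ⊞ ind ∘ inside 𝒫 ∙ j * j ⊞ ind ∘ inside (swap 𝒫) ∙ j * j) pointwise
        where
        open Pair 𝒫
        pointwise : ∀ w → 1 * (m * m + j * j) ≤ sq U w * 1 + sq W w * 1 + 1 * (m * k * 2) + ind (shared 𝒫 k w) * (m * m + j * j)
          + ind (inside 𝒫 w) * (j * j) + ind (inside (swap 𝒫) w) * (j * j)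
        pointwise w with shared 𝒫 k w in e
        ... | true  = certify (m ∷ j ∷ k ∷ sq U w ∷ sq W w ∷ ind (inside 𝒫 w) ∷ ind (inside (swap 𝒫) w) ∷ [])
          (λ m j k x y a b → goal (# 1 ⊗ (m ⊗ m ⊕ j ⊗ j) ⊑
            x · 1 ⊕ y · 1 ⊕ # 1 ⊗ (m ⊗ k · 2) ⊕ # 1 ⊗ (m ⊗ m ⊕ j ⊗ j) ⊕ a ⊗ (j ⊗ j) ⊕ b ⊗ (j ⊗ j)))
        ... | false with not-shared 𝒫 {k} e
        ...   | inj₁ h = certify (m ∷ j ∷ k ∷ sq U w ∷ sq W w ∷ ind (inside 𝒫 w) ∷ ind (inside (swap 𝒫) w) ∷ [])
          (λ m j k x y a b → (m ⊗ m ⊕ j ⊗ j ⊑ x ⊕ y ⊕ m ⊗ k · 2 ⊕ a ⊗ (j ⊗ j)) ⟨ # 1 ⟩⇒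
            goal (# 1 ⊗ (m ⊗ m ⊕ j ⊗ j) ⊑ x · 1 ⊕ y · 1 ⊕ # 1 ⊗ (m ⊗ k · 2) ⊕ # 0 ⊕ a ⊗ (j ⊗ j) ⊕ b ⊗ (j ⊗ j)))
          (one-side 𝒫 w h)
        ...   | inj₂ h = certify (m ∷ j ∷ k ∷ sq U w ∷ sq W w ∷ ind (inside 𝒫 w) ∷ ind (inside (swap 𝒫) w) ∷ [])
          (λ m j k x y a b → (m ⊗ m ⊕ j ⊗ j ⊑ y ⊕ x ⊕ m ⊗ k · 2 ⊕ b ⊗ (j ⊗ j)) ⟨ # 1 ⟩⇒
            goal (# 1 ⊗ (m ⊗ m ⊕ j ⊗ j) ⊑ x · 1 ⊕ y · 1 ⊕ # 1 ⊗ (m ⊗ k · 2) ⊕ # 0 ⊕ a ⊗ (j ⊗ j) ⊕ b ⊗ (j ⊗ j)))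
          (one-side (swap 𝒫) w h)

      side-sum : ∀ 𝒫 → ∑ M (ind ∘ inside 𝒫) * (m * m) ≤ ∑ M (sq (Pair.U 𝒫)) * 1 + ∥ M ∥ * (m * k * 2)
      side-sum 𝒫 = ∑-lin-≤ M [ ind ∘ inside 𝒫 ∙ m * m ] ([ sq (Pair.U 𝒫) ∙ 1 ] ⊞ (λ _ → 1) ∙ m * k * 2) pointwise
        where
        pointwise : ∀ w → ind (inside 𝒫 w) * (m * m) ≤ sq (Pair.U 𝒫) w * 1 + 1 * (m * k * 2)
        pointwise w with inside 𝒫 w in e
        ... | false = z≤n
        ... | true  = certify (m ∷ k ∷ con (Pair.U 𝒫) w ∷ []) (λ m k x → (m ⊗ m ⊑ x ⊗ x ⊕ m ⊗ k · 2) ⟨ # 1 ⟩⇒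
          goal (# 1 ⊗ (m ⊗ m) ⊑ x ⊗ x · 1 ⊕ # 1 ⊗ (m ⊗ k · 2))) (con-full (Pair.U 𝒫) k w (Pair.∥U∥≡m 𝒫) (inside-deg 𝒫 e))

      -- The two `row` bounds allow about `n m²` in total, and each unshared vertex outside both
      -- sides exceeds its share by about `j² ≥ (m / J)²`. So the sides cover nearly everything;
      -- `side-sum` confines one to about n/2, which leaves 0.4999 n for the other.
      other-side-large : ∀ 𝒫 J {c} → 1 ≤ j → j ≤ m → m ≤ J * j → J * (k + 1) * 100000 ≤ j → (k * 2 + 1) * 50000 ≤ m →
        ∥ L ∥ * 50000 ≤ n → ∥ L ∥ * (J * J) * 50000 ≤ n → ∑ M (ind ∘ shared 𝒫 k) < c → c * (J * J) * 100000 ≤ n →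
        n * 4999 ≤ ∥ side (swap 𝒫) ∥ * 10000
      other-side-large 𝒫 J {c} 1≤j j≤m m≤Jj j-big m-big λ-small₁ λ-small₂ z<c c-small = *-cancelʳ-≤ _ _ 10 (certify
        (n ∷ ∥ L ∥ ∷ ∥ M ∥ ∷ a ∷ b ∷ ∥ side (swap 𝒫) ∥ ∷ [])
        (λ n l μ a b b′ → (μ · 50000 ⊑ (a ⊕ b) · 50000 ⊕ n · 3) ⟨ # 2 ⟩⇒ (a · 100000 ⊑ n · 50002) ⟨ # 1 ⟩⇒ (b ⊑ b′) ⟨ # 100000 ⟩⇒
          (l · 50000 ⊑ n) ⟨ # 2 ⟩⇒ (n ⊑ l ⊕ μ) ⟨ # 100000 ⟩⇒ goal (n · 4999 · 10 ⊑ b′ · 10000 · 10))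
        covered a-upper (≤-reflexive (∑-ind (inside (swap 𝒫)) M)) λ-small₁ n≤λ+μ)
        where
        open Pair 𝒫
        a b z : ℕ
        a = ∑ M (ind ∘ inside 𝒫)
        b = ∑ M (ind ∘ inside (swap 𝒫))
        z = ∑ M (ind ∘ shared 𝒫 k)
        j≢0 : NonZero j
        j≢0 = >-nonZero 1≤j
        covered′ : j * ∥ M ∥ ≤ j * (a + b) + J * J * j * (∥ L ∥ + z * 2) + (k + 1) * n * J * 2
        covered′ = *-cancelˡ-≤ j {{j≢0}} (*-cancelʳ-≤ _ _ 2 (certify
          (n ∷ ∥ L ∥ ∷ ∥ M ∥ ∷ m ∷ j ∷ k ∷ J ∷ a ∷ b ∷ z ∷ ∑ V (sq U) ∷ ∑ V (sq W) ∷ ∑ M (sq U) ∷ ∑ M (sq W) ∷ [])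
          (λ n l μ m j k J a b z X Y XM YM →
            (μ ⊗ (m ⊗ m ⊕ j ⊗ j) ⊑ XM · 1 ⊕ YM · 1 ⊕ μ ⊗ (m ⊗ k · 2) ⊕ z ⊗ (m ⊗ m ⊕ j ⊗ j) ⊕ a ⊗ (j ⊗ j) ⊕ b ⊗ (j ⊗ j)) ⟨ # 2 ⟩⇒
            (X · 2 ⊑ m ⊗ n · 2 ⊕ m ⊗ m ⊗ n) ⟨ # 1 ⟩⇒ (Y · 2 ⊑ m ⊗ n · 2 ⊕ m ⊗ m ⊗ n) ⟨ # 1 ⟩⇒
            (XM ⊑ X) ⟨ # 2 ⟩⇒ (YM ⊑ Y) ⟨ # 2 ⟩⇒ (n ⊑ l ⊕ μ) ⟨ m ⊗ m · 2 ⟩⇒ (μ ⊑ n) ⟨ m ⊗ k · 4 ⟩⇒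
            (m ⊑ J ⊗ j) ⟨ m ⊗ (l ⊕ z · 2) · 2 ⟩⇒ (m ⊑ J ⊗ j) ⟨ J ⊗ j ⊗ (l ⊕ z · 2) · 2 ⟩⇒
            (j ⊑ m) ⟨ j ⊗ z · 2 ⟩⇒ (j ⊑ m) ⟨ m ⊗ z · 2 ⟩⇒ (m ⊑ J ⊗ j) ⟨ n ⊗ (k ⊕ # 1) · 4 ⟩⇒
            goal (j ⊗ (j ⊗ μ) · 2 ⊑ j ⊗ (j ⊗ (a ⊕ b) ⊕ J ⊗ J ⊗ j ⊗ (l ⊕ z · 2) ⊕ (k ⊕ # 1) ⊗ n ⊗ J · 2) · 2))
          (sides-cover 𝒫) (row indep-U ∥U∥≡m) (row indep-W ∥W∥≡m) (∑-M≤V (sq U)) (∑-M≤V (sq W)) n≤λ+μ ∥M∥≤n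
          m≤Jj m≤Jj j≤m j≤m m≤Jj))
        covered : ∥ M ∥ * 50000 ≤ (a + b) * 50000 + n * 3
        covered = *-cancelˡ-≤ j {{j≢0}} (certify (n ∷ ∥ L ∥ ∷ ∥ M ∥ ∷ j ∷ k ∷ J ∷ a ∷ b ∷ z ∷ c ∷ [])
          (λ n l μ j k J a b z c →
            (j ⊗ μ ⊑ j ⊗ (a ⊕ b) ⊕ J ⊗ J ⊗ j ⊗ (l ⊕ z · 2) ⊕ (k ⊕ # 1) ⊗ n ⊗ J · 2) ⟨ # 50000 ⟩⇒
            (J ⊗ (k ⊕ # 1) · 100000 ⊑ j) ⟨ n ⟩⇒ (l ⊗ (J ⊗ J) · 50000 ⊑ n) ⟨ j ⟩⇒ (# 1 ⊕ z ⊑ c) ⟨ J ⊗ J ⊗ j · 100000 ⟩⇒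
            (c ⊗ (J ⊗ J) · 100000 ⊑ n) ⟨ j ⟩⇒
            goal (j ⊗ (μ · 50000) ⊑ j ⊗ ((a ⊕ b) · 50000 ⊕ n · 3)))
          covered′ j-big λ-small₂ z<c c-small)
        a-upper : a * 100000 ≤ n * 50002
        a-upper = *-cancelˡ-≤ m {{>-nonZero (≤-trans 1≤j j≤m)}} (*-cancelˡ-≤ m {{>-nonZero (≤-trans 1≤j j≤m)}} (certify
          (n ∷ ∥ M ∥ ∷ m ∷ k ∷ a ∷ ∑ V (sq U) ∷ ∑ M (sq U) ∷ [])
          (λ n μ m k a X XM → (a ⊗ (m ⊗ m) ⊑ XM · 1 ⊕ μ ⊗ (m ⊗ k · 2)) ⟨ # 100000 ⟩⇒ (XM ⊑ X) ⟨ # 100000 ⟩⇒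
            (X · 2 ⊑ m ⊗ n · 2 ⊕ m ⊗ m ⊗ n) ⟨ # 50000 ⟩⇒ (μ ⊑ n) ⟨ m ⊗ k · 200000 ⟩⇒ ((k · 2 ⊕ # 1) · 50000 ⊑ m) ⟨ m ⊗ n · 2 ⟩⇒
            goal (m ⊗ (m ⊗ (a · 100000)) ⊑ m ⊗ (m ⊗ (n · 50002))))
          (side-sum 𝒫) (∑-M≤V (sq U)) (row indep-U ∥U∥≡m) ∥M∥≤n m-big))

    -- Vertices that miss much of the opposite side.

    β-sym : ∀ u w → β u w ≡ β w u
    β-sym u w = cong (ind ∘ not) (adj-sym G u w)

    ∑-con : ∀ xs U → ∑ xs (con U) ≡ ∑ U (λ u → ∑ xs (β u))
    ∑-con xs U = ∑-swap xs U (λ w u → β u w)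

    no-con⇒joined : ∀ U {w} → con U w ≤ 0 → All (λ u → adj G w u ≡ true) U
    no-con⇒joined []      h = []
    no-con⇒joined (u ∷ U) {w} h with adj G u w in e
    ... | true = trans (adj-sym G w u) e ∷ no-con⇒joined U h

    -- Each of the 2k given vertices spoils at most j vertices of W, which leaves k of them.
    common-neighbours : ∀ {U₁ U₂ W k j} → ∥ U₁ ∥ ≡ k → ∥ U₂ ∥ ≡ k → All (λ u → con W u ≤ j) U₁ → All (λ u → con W u ≤ j) U₂ →
      k * j * 2 + k ≤ ∥ W ∥ → ∃ λ W′ → W′ ⊆ W × ∥ W′ ∥ ≡ k × Joined W′ U₁ × Joined W′ U₂
    common-neighbours {U₁} {U₂} {W} {k} {j} e₁ e₂ h₁ h₂ big =
      let W′ , s , e = choose k good k≤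
      in W′ , ⊆-trans s (filterᵇ-⊆ free W) , e ,
         All-resp-⊆ s (All.map (λ f → no-con⇒joined U₁ (≤-trans (m≤m+n _ (con U₂ _)) (s≤s⁻¹ (<ᵇ-true f)))) (all-filterᵇ free W)) ,
         All-resp-⊆ s (All.map (λ f → no-con⇒joined U₂ (≤-trans (m≤n+m _ (con U₁ _)) (s≤s⁻¹ (<ᵇ-true f)))) (all-filterᵇ free W))
      where
      free : Fin n → Bool
      free w = con U₁ w + con U₂ w <ᵇ 1
      good : List (Fin n)
      good = filterᵇ free W
      pointwise : ∀ w → 1 * 1 ≤ ind (free w) * 1 + con U₁ w * 1 + con U₂ w * 1
      pointwise w with free w in e
      ... | true  = s≤s z≤n
      ... | false = certify (con U₁ w ∷ con U₂ w ∷ []) (λ x y → (# 1 ⊑ x ⊕ y) ⟨ # 1 ⟩⇒ goal (# 1 ⊗ # 1 ⊑ # 0 ⊕ x · 1 ⊕ y · 1)) (<ᵇ-false e)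
      missing : ∀ {U} → ∥ U ∥ ≡ k → All (λ u → con W u ≤ j) U → ∑ W (con U) ≤ k * j
      missing {U} refl h = ≤-trans (≤-reflexive (trans (∑-con W U) (∑-cong U (λ u → ∑-cong W (λ w → β-sym u w))))) (∑-bound h)
      k≤ : k ≤ ∥ good ∥
      k≤ = certify (k ∷ j ∷ ∥ W ∥ ∷ ∥ good ∥ ∷ ∑ W (ind ∘ free) ∷ ∑ W (con U₁) ∷ ∑ W (con U₂) ∷ [])
        (λ k j w g f a b → (w · 1 ⊑ f · 1 ⊕ a · 1 ⊕ b · 1) ⟨ # 1 ⟩⇒ (f ⊑ g) ⟨ # 1 ⟩⇒ (a ⊑ k ⊗ j) ⟨ # 1 ⟩⇒ (b ⊑ k ⊗ j) ⟨ # 1 ⟩⇒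
          (k ⊗ j · 2 ⊕ k ⊑ w) ⟨ # 1 ⟩⇒ goal (k ⊑ g))
        (∑-lin-≤ W [ (λ _ → 1) ∙ 1 ] ([ ind ∘ free ∙ 1 ] ⊞ con U₁ ∙ 1 ⊞ con U₂ ∙ 1) pointwise)
        (≤-reflexive (∑-ind free W)) (missing e₁ h₁) (missing e₂ h₂) big

    -- From (50x̄ − m)² ≥ 0.
    con-square-sum : ∀ xs U m → ∑ xs (con U) * (m * 100) ≤ ∑ xs (sq U) * 2500 + ∥ xs ∥ * (m * m)
    con-square-sum xs U m = ∑-lin-≤ xs [ con U ∙ m * 100 ] ([ sq U ∙ 2500 ] ⊞ (λ _ → 1) ∙ m * m)
      (λ w → certify (con U w ∷ m ∷ []) (λ x m → (x · 50 ⊗ m · 2 ⊑ x · 50 ⊗ (x · 50) ⊕ m ⊗ m) ⟨ # 1 ⟩⇒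
        goal (x ⊗ (m · 100) ⊑ x ⊗ x · 2500 ⊕ # 1 ⊗ (m ⊗ m))) (2ab≤a²+b² (con U w * 50) m))

    ∑-disjoint : ∀ {A : Set} (P Q : A → Bool) xs f → (∀ x → P x ≡ true → Q x ≡ true → ⊥) →
      ∑ (filterᵇ P xs) f + ∑ (filterᵇ Q xs) f ≤ ∑ xs f
    ∑-disjoint P Q []       f dis = z≤n
    ∑-disjoint P Q (x ∷ xs) f dis with P x in p | Q x in q | ∑-disjoint P Q xs f dis
    ... | true  | true  | ih = contradiction q (dis x p)
    ... | true  | false | ih = ≤-trans (≤-reflexive (+-assoc (f x) _ _)) (+-monoʳ-≤ (f x) ih)
    ... | false | true  | ih = certify (f x ∷ ∑ (filterᵇ P xs) f ∷ ∑ (filterᵇ Q xs) f ∷ ∑ xs f ∷ [])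
      (λ x p q s → (p ⊕ q ⊑ s) ⟨ # 1 ⟩⇒ goal (p ⊕ (x ⊕ q) ⊑ x ⊕ s)) ih
    ... | false | false | ih = ≤-trans ih (m≤n+m _ (f x))

    module _ {m : ℕ} (j k : ℕ) (6K<k : K * 6 < k) (m-big : k * j * 2 + k ≤ m) (𝒫 : Pair m) where
      open Pair 𝒫

      A B : List (Fin n)
      A = side j k 𝒫
      B = side j k (swap 𝒫)

      A⊆M : A ⊆ M
      A⊆M = filterᵇ-⊆ (inside j k 𝒫) M

      -- Many rich vertices would give two joined independent k-sets in `A`. Both are almost
      -- complete to `W`, where `common-neighbours` finds the third set that `no-triple` forbids.
      few-rich : ∀ {U₂ T} → U₂ ⊆ A → Indep U₂ → ∥ U₂ ∥ ≡ T → ∑ A (ind ∘ rich k U₂) < 2 ^ T * suc (ram m₀ k)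
      few-rich {U₂} sU iU refl = ≤-trans (s≤s (≤-reflexive (∑-ind (rich k U₂) A))) (≰⇒> impossible)
        where
        Z : List (Fin n)
        Z = filterᵇ (rich k U₂) A
        Z⊆A : Z ⊆ A
        Z⊆A = filterᵇ-⊆ (rich k U₂) A
        impossible : ¬ (2 ^ ∥ U₂ ∥ * suc (ram m₀ k) ≤ ∥ Z ∥)
        impossible h =
          let U₃ , Y , sU₃ , eU₃ , sY , r≤ , J = common (adj G) k U₂ Z (suc (ram m₀ k)) (s≤s z≤n) h
                (All.map (rich-true {U = U₂}) (all-filterᵇ (rich k U₂) A))
              I , sI , eI , iI = independent-subset k (⊆-trans sY (⊆-trans Z⊆A A⊆M)) (≤-trans (n≤1+n _) r≤)
              W′ , sW′ , eW′ , J₁ , J₂ = common-neighbours eU₃ eI (All-resp-⊆ (⊆-trans sU₃ sU) (inside-con j k 𝒫))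
                (All-resp-⊆ (⊆-trans sI (⊆-trans sY Z⊆A)) (inside-con j k 𝒫)) (≤-trans m-big (≤-reflexive (sym ∥W∥≡m)))
          in no-triple 6K<k (AllPairs-⊆ sW′ indep-W) (AllPairs-⊆ sU₃ iU) iI eW′ eU₃ eI J₁ J₂ (All.map (All-resp-⊆ sI) J)

      bad : Fin n → Bool
      bad a = n <ᵇ suc (∑ B (β a) * 50)

      -- An independent T-set of bad vertices has, by `few-rich`, squares of total about 0.4998 n T²
      -- on `A`, and another n T² / 2500 = 0.0004 n T² on the disjoint set `B`. This exceeds the
      -- half allowed by `row`.
      few-bad : ∀ {T} → j + k < m → (k + 1) * 20000 ≤ T → 2 ^ T * suc (ram m₀ k) * 10000 ≤ n → n * 4999 ≤ ∥ A ∥ * 10000 →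
        ∥ filterᵇ bad A ∥ < ram m₀ T
      few-bad {T} j+k<m T-big n-big A-large = ≰⇒> (λ h →
        let U₂ , s , e , I = independent-subset T (⊆-trans (filterᵇ-⊆ bad A) A⊆M) h
        in impossible (⊆-trans s (filterᵇ-⊆ bad A)) I e (All-resp-⊆ s (All.map (λ f → s≤s⁻¹ (<ᵇ-true f)) (all-filterᵇ bad A))))
        where
        c : ℕ
        c = 2 ^ T * suc (ram m₀ k)
        disjoint : ∀ w → inside j k 𝒫 w ≡ true → inside j k (swap 𝒫) w ≡ true → ⊥
        disjoint w e₁ e₂ = <⇒≱ j+k<m (≤-trans (≤-reflexive (trans (sym ∥U∥≡m) (trans (sym (deg+con U w)) (+-comm (deg U w) _))))
          (+-mono-≤ (s≤s⁻¹ (<ᵇ-true (proj₁ (∧-true e₂)))) (inside-deg j k 𝒫 e₁)))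
        size≤n : ∀ {xs} → xs ⊆ M → ∥ xs ∥ ≤ n
        size≤n s = ≤-trans (∑-⊆ _ s) ∥M∥≤n
        impossible : ∀ {U₂} → U₂ ⊆ A → Indep U₂ → ∥ U₂ ∥ ≡ T → All (λ u → n ≤ ∑ B (β u) * 50) U₂ → ⊥
        impossible {U₂} s I e bads = 1≰0 (certify
          (n ∷ T ∷ k ∷ c ∷ ∥ A ∥ ∷ ∥ B ∥ ∷ ∑ V (sq U₂) ∷ ∑ A (sq U₂) ∷ ∑ B (sq U₂) ∷ ∑ B (con U₂) ∷ ∑ A (ind ∘ rich k U₂) ∷ [])
          (λ n m k c a b X XA XB C r →
            (X · 2 ⊑ m ⊗ n · 2 ⊕ m ⊗ m ⊗ n) ⟨ # 5000 ⟩⇒ (XA ⊕ XB ⊑ X) ⟨ # 10000 ⟩⇒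
            (a ⊗ (m ⊗ m) ⊑ XA · 1 ⊕ a ⊗ (m ⊗ k · 2) ⊕ r ⊗ (m ⊗ m)) ⟨ # 10000 ⟩⇒
            (C ⊗ (m · 100) ⊑ XB · 2500 ⊕ b ⊗ (m ⊗ m)) ⟨ # 4 ⟩⇒ (m ⊗ n ⊑ C · 50) ⟨ m · 8 ⟩⇒
            (b ⊑ n) ⟨ m ⊗ m · 4 ⟩⇒ (a ⊑ n) ⟨ m ⊗ k · 20000 ⟩⇒ (n · 4999 ⊑ a · 10000) ⟨ m ⊗ m ⟩⇒
            (# 1 ⊕ r ⊑ c) ⟨ m ⊗ m · 10000 ⟩⇒ (c · 10000 ⊑ n) ⟨ m ⊗ m ⟩⇒
            ((k ⊕ # 1) · 20000 ⊑ m) ⟨ m ⊗ n ⟩⇒ ((k ⊕ # 1) · 20000 ⊑ m) ⟨ n ⟩⇒ (# 1 ⊑ n) ⟨ # 1 ⟩⇒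
            goal (# 1 ⊑ # 0))
          (row I e) (≤-trans (∑-disjoint _ _ M (sq U₂) disjoint) (∑-M≤V (sq U₂))) (rich-sum A U₂ k e) (con-square-sum B U₂ T)
          (subst (λ t → t * n ≤ ∑ B (con U₂) * 50) e
            (≤-trans (∑-bound′ bads) (≤-reflexive (trans (∑-* U₂ _ 50) (cong (_* 50) (sym (∑-con B U₂)))))))
          (size≤n (filterᵇ-⊆ (inside j k (swap 𝒫)) M)) (size≤n A⊆M) A-large (few-rich s I e) n-big T-big T-big 1≤n)

    -- Exact counting with two dense sides.

    has-neighbour : ∀ U {w} → 1 ≤ deg U w → ∃ λ u → u ∈ U × adj G u w ≡ true
    has-neighbour (u ∷ U) {w} h with adj G u w in e
    ... | true  = u , here refl , e
    ... | false with has-neighbour U h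
    ...   | v , v∈ , e′ = v , there v∈ , e′

    no-deg⇒apart : ∀ {U u w} → deg U w ≤ 0 → u ∈ U → β u w ≡ 1
    no-deg⇒apart {v ∷ U} {w = w} h u∈ with adj G v w in e
    no-deg⇒apart h (here refl) | false rewrite e = refl
    no-deg⇒apart h (there u∈) | false = no-deg⇒apart h u∈

    ∑-codeg : ∀ {xs} u v → xs ⊆ V → ∑ xs (λ w → α u w * α v w) ≤ codeg u v
    ∑-codeg u v s = ∑-⊆ (λ w → α u w * α v w) s

    two-members : ∀ {xs : List (Fin n)} → AllPairs _≢_ xs → 2 ≤ ∥ xs ∥ → ∃ λ x → ∃ λ y → x ∈ xs × y ∈ xs × x ≢ y
    two-members {x ∷ y ∷ _} ((x≢y ∷ _) ∷ _) _ = x , y , here refl , there (here refl) , x≢y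
    two-members {x ∷ []} _ (s≤s ())

    module Exact (q : ℕ) (n≡ : n ≡ q * 2 + 3) (conon≤q+1 : ∀ {u v} → u ≢ v → adj G u v ≡ false → conon u v ≤ q + 1) (100≤n : 100 ≤ n) where

      Dense : List (Fin n) → List (Fin n) → Set
      Dense A B = All (λ a → ∑ B (β a) * 50 ≤ n) A

      -- Adjacent vertices of A would share at least 0.49 n - 2n/50 = 0.45 n neighbours in B, more
      -- than p ≤ n/12.
      dense⇒independent : ∀ {A B} → B ⊆ V → n * 49 ≤ ∥ B ∥ * 100 → Dense A B → ∀ {a a′} → a ∈ A → a′ ∈ A → adj G a a′ ≡ false
      dense⇒independent {A} {B} sB large D {a} {a′} a∈ a′∈ with adj G a a′ in e
      ... | false = refl
      ... | true  = contradiction (certify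
        (n ∷ p ∷ ∥ B ∥ ∷ ∑ B (λ w → α a w * α a′ w) ∷ ∑ B (β a) ∷ ∑ B (β a′) ∷ codeg a a′ ∷ [])
        (λ n p b x y z c → (b · 1 ⊑ x · 1 ⊕ y · 1 ⊕ z · 1) ⟨ # 300 ⟩⇒ (y · 50 ⊑ n) ⟨ # 6 ⟩⇒ (z · 50 ⊑ n) ⟨ # 6 ⟩⇒ (x ⊑ c) ⟨ # 300 ⟩⇒
          (c ⊑ p) ⟨ # 300 ⟩⇒ (p · 12 ⊑ n) ⟨ # 25 ⟩⇒ (n · 49 ⊑ b · 100) ⟨ # 3 ⟩⇒ (# 1 ⊑ n) ⟨ # 1 ⟩⇒ goal (# 1 ⊑ # 0))
        (∑-lin-≤ B [ (λ _ → 1) ∙ 1 ] ([ (λ w → α a w * α a′ w) ∙ 1 ] ⊞ β a ∙ 1 ⊞ β a′ ∙ 1) (λ w → pointwise (adj G a w) (adj G a′ w)))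
        (All.lookup D a∈) (All.lookup D a′∈) (∑-codeg a a′ sB) (codeg≤ e) 12p≤n large 1≤n) 1≰0
        where
        pointwise : ∀ x y → 1 * 1 ≤ ind x * ind y * 1 + ind (not x) * 1 + ind (not y) * 1
        pointwise true  true  = s≤s z≤n
        pointwise true  false = s≤s z≤n
        pointwise false true  = s≤s z≤n
        pointwise false false = s≤s z≤n

      -- Let b in B be a neighbour of r. All neighbours of r in A are common neighbours of b and r,
      -- of which there are at most p, except the n/50 or fewer that b misses.
      dense⇒small-degree : ∀ {A B r} → A ⊆ V → Dense B A → 1 ≤ deg B r → deg A r * 50 ≤ p * 50 + n
      dense⇒small-degree {A} {B} {r} sA D h =
        let b , b∈ , e = has-neighbour B h
        in certify (n ∷ p ∷ deg A r ∷ ∑ A (λ w → α b w * α r w) ∷ ∑ A (β b) ∷ codeg b r ∷ [])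
          (λ n p d x y c → (d · 1 ⊑ x · 1 ⊕ y · 1) ⟨ # 50 ⟩⇒ (x ⊑ c) ⟨ # 50 ⟩⇒ (c ⊑ p) ⟨ # 50 ⟩⇒ (y · 50 ⊑ n) ⟨ # 1 ⟩⇒
            goal (d · 50 ⊑ p · 50 ⊕ n))
          (∑-lin-≤ A [ (λ w → α w r) ∙ 1 ] ([ (λ w → α b w * α r w) ∙ 1 ] ⊞ β b ∙ 1)
            (λ w → subst (λ x → ind x * 1 ≤ α b w * α r w * 1 + β b w * 1) (adj-sym G r w) (pointwise (adj G b w) (adj G r w))))
          (∑-codeg b r sA) (codeg≤ e) (All.lookup D b∈)
        where
        pointwise : ∀ x y → ind y * 1 ≤ ind x * ind y * 1 + ind (not x) * 1
        pointwise true  true  = s≤s z≤n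
        pointwise true  false = z≤n
        pointwise false true  = s≤s z≤n
        pointwise false false = z≤n

      -- Two vertices of A with few neighbours in R see all of X and half of R in the complement.
      half : ∀ {A X R} → A ⊆ V → n * 49 ≤ ∥ A ∥ * 100 → (∀ {a a′} → a ∈ A → a′ ∈ A → adj G a a′ ≡ false) →
        All (λ w → deg A w ≤ 0) X → All (λ r → deg A r * 50 ≤ p * 50 + n) R →
        (∀ f → ∑ X f + ∑ R f ≤ ∑ V f) → ∥ X ∥ * 2 + ∥ R ∥ ≤ q * 2 + 2
      half {A} {X} {R} sA large indep X-free R-small X+R≤V = *-cancelʳ-≤ _ _ 2 (
        let a , a′ , a∈ , a′∈ , a≢a′ = two-members (⊆V⇒distinct (⊆-trans (filterᵇ-⊆ light A) sA)) (≮⇒≥ not-one)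
        in certify (∥ X ∥ ∷ ∥ R ∥ ∷ q ∷ conon a a′ ∷ ∑ X (λ w → β a w * β a′ w) ∷ ∑ R (λ w → β a w * β a′ w) ∷ deg R a ∷ deg R a′ ∷ [])
          (λ x r q c s t d d′ → (x ⊑ s) ⟨ # 4 ⟩⇒ (r · 1 ⊑ t · 1 ⊕ d · 1 ⊕ d′ · 1) ⟨ # 4 ⟩⇒ (s ⊕ t ⊑ c) ⟨ # 4 ⟩⇒ (c ⊑ q ⊕ # 1) ⟨ # 4 ⟩⇒
            (d · 4 ⊑ r) ⟨ # 1 ⟩⇒ (d′ · 4 ⊑ r) ⟨ # 1 ⟩⇒ goal ((x · 2 ⊕ r) · 2 ⊑ (q · 2 ⊕ # 2) · 2))
          (∑-mono (All.map (λ free → ≤-reflexive (sym (cong₂ _*_ (no-deg⇒apart free (in-A a∈)) (no-deg⇒apart free (in-A a′∈))))) X-free))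
          (seen a a′) (X+R≤V (λ w → β a w * β a′ w)) (conon≤q+1 a≢a′ (indep (in-A a∈) (in-A a′∈))) (light-≤ a∈) (light-≤ a′∈))
        where
        light : Fin n → Bool
        -- With `suc`, the weight in the averaging stays positive even for empty R.
        light a = deg R a * 4 <ᵇ suc ∥ R ∥
        in-A : ∀ {a} → a ∈ filterᵇ light A → a ∈ A
        in-A = Any-resp-⊆ (filterᵇ-⊆ light A)
        light-≤ : ∀ {a} → a ∈ filterᵇ light A → deg R a * 4 ≤ ∥ R ∥
        light-≤ a∈ = s≤s⁻¹ (<ᵇ-true (All.lookup (all-filterᵇ light A) a∈))
        seen : ∀ a a′ → ∥ R ∥ * 1 ≤ ∑ R (λ w → β a w * β a′ w) * 1 + deg R a * 1 + deg R a′ * 1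
        seen a a′ = ∑-lin-≤ R [ (λ _ → 1) ∙ 1 ] ([ (λ w → β a w * β a′ w) ∙ 1 ] ⊞ (λ w → α w a) ∙ 1 ⊞ (λ w → α w a′) ∙ 1) pointwise
          where
          pointwise : ∀ w → 1 * 1 ≤ β a w * β a′ w * 1 + α w a * 1 + α w a′ * 1
          pointwise w rewrite adj-sym G w a | adj-sym G w a′ with adj G a w | adj G a′ w
          ... | true  | _     = s≤s z≤n
          ... | false | true  = s≤s z≤n
          ... | false | false = s≤s z≤n
        pointwise : ∀ a → 1 * suc ∥ R ∥ ≤ deg R a * 4 + ind (light a) * suc ∥ R ∥
        pointwise a with light a in e
        ... | true  = m≤n+m _ (deg R a * 4)
        ... | false = ≤-trans (≤-reflexive (+-identityʳ _)) (≤-trans (<ᵇ-false e) (m≤m+n _ 0))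
        swapped : ∑ A (deg R) * 50 ≤ ∥ R ∥ * (p * 50 + n)
        swapped = ≤-trans (≤-reflexive (trans (cong (_* 50) (trans (∑-swap A R (λ a r → α r a)) (∑-cong R (λ r → ∑-cong A (λ a → α-sym r a)))))
          (sym (∑-* R (deg A) 50)))) (∑-bound R-small)
        not-one : ¬ (∥ filterᵇ light A ∥ < 2)
        -- By double counting the mean of `deg R` over A is at most (1/12 + 1/50) / 0.49 < 1/4 of
        -- `∥ R ∥`. So a positive proportion of A is light, at least two vertices since 100 ≤ n.
        not-one g<2 = 1≰0 (certify (n ∷ p ∷ ∥ A ∥ ∷ ∥ R ∥ ∷ ∑ A (deg R) ∷ ∑ A (ind ∘ light) ∷ [])
          (λ n p a r d g → (a ⊗ (# 1 ⊕ r) ⊑ d · 4 ⊕ g ⊗ (# 1 ⊕ r)) ⟨ # 300 ⟩⇒ (d · 50 ⊑ r ⊗ (p · 50 ⊕ n)) ⟨ # 24 ⟩⇒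
            (p · 12 ⊑ n) ⟨ r · 100 ⟩⇒ (n · 49 ⊑ a · 100) ⟨ (# 1 ⊕ r) · 3 ⟩⇒ (# 1 ⊕ g ⊑ # 2) ⟨ (# 1 ⊕ r) · 300 ⟩⇒
            (# 100 ⊑ n) ⟨ (# 1 ⊕ r) · 3 ⟩⇒ (# 1 ⊑ n) ⟨ # 1 ⟩⇒ goal (# 1 ⊑ # 0))
          (∑-lin-≤ A [ (λ _ → 1) ∙ suc ∥ R ∥ ] ([ deg R ∙ 4 ] ⊞ ind ∘ light ∙ suc ∥ R ∥) pointwise)
          swapped 12p≤n large (≤-trans (s≤s (≤-reflexive (∑-ind light A))) g<2) 100≤n 1≤n)

      -- `X`, `Y` and `R` partition the vertices, so the two inequalities from `half` add up to 2n ≤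
      -- 4q + 4, whereas 2n = 4q + 6.
      no-dense-pair : ∀ {A B} → A ⊆ V → B ⊆ V → n * 49 ≤ ∥ A ∥ * 100 → n * 49 ≤ ∥ B ∥ * 100 → Dense A B → Dense B A → ⊥
      no-dense-pair {A} {B} sA sB A-large B-large AB BA = 1≰0 (certify (n ∷ q ∷ ∥ X ∥ ∷ ∥ X̄ ∥ ∷ ∥ Y ∥ ∷ ∥ R ∥ ∷ [])
        (λ n q x x̄ y r → (x · 2 ⊕ r ⊑ q · 2 ⊕ # 2) ⟨ # 1 ⟩⇒ (y · 2 ⊕ r ⊑ q · 2 ⊕ # 2) ⟨ # 1 ⟩⇒
          (n ⊑ x ⊕ x̄) ⟨ # 2 ⟩⇒ (x̄ ⊑ y ⊕ r) ⟨ # 2 ⟩⇒ (q · 2 ⊕ # 3 ⊑ n) ⟨ # 2 ⟩⇒ goal (# 1 ⊑ # 0))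
        (half sA A-large (dense⇒independent sB B-large AB) (free A V)
          (All.map (dense⇒small-degree sA BA) (touched B X̄))
          (λ f → ≤-trans (+-monoʳ-≤ (∑ X f) (∑-⊆ f (filterᵇ-⊆ (not ∘ avoids B) X̄))) (≤-reflexive (∑-split (avoids A) V f))))
        (half sB B-large (dense⇒independent sA A-large BA) (free B X̄)
          (All-resp-⊆ (filterᵇ-⊆ (not ∘ avoids B) X̄) (All.map (dense⇒small-degree sB AB) (touched A V)))
          (λ f → ≤-trans (≤-reflexive (∑-split (avoids B) X̄ f)) (∑-⊆ f (filterᵇ-⊆ (not ∘ avoids A) V))))
        (≤-reflexive (sym (trans (∑-split (avoids A) V (λ _ → 1)) ∥V∥≡n)))
        (≤-reflexive (sym (∑-split (avoids B) X̄ (λ _ → 1)))) (≤-reflexive (sym n≡)))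
        where
        avoids : List (Fin n) → Fin n → Bool
        avoids U w = deg U w <ᵇ 1
        free : ∀ U xs → All (λ w → deg U w ≤ 0) (filterᵇ (avoids U) xs)
        free U xs = All.map (λ e → s≤s⁻¹ (<ᵇ-true e)) (all-filterᵇ (avoids U) xs)
        touched : ∀ U xs → All (λ w → 1 ≤ deg U w) (filterᵇ (not ∘ avoids U) xs)
        touched U xs = All.map <ᵇ-false (all-filterᵇ-not (avoids U) xs)
        X X̄ Y R : List (Fin n)
        X = filterᵇ (avoids A) V
        X̄ = filterᵇ (not ∘ avoids A) V
        Y = filterᵇ (avoids B) X̄
        R = filterᵇ (not ∘ avoids B) X̄

    -- Assembling the contradiction for large n.

    pair-exists : ∀ {m T R} → (m * 4 + 20) * 1000 ≤ T → ∥ L ∥ * 100 ≤ n → ram m₀ T < R → 2 ^ T * suc (ram m₀ m) ≤ R → R * 20000 ≤ n → Pair m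
    pair-exists {m} {T} {R} T-big λ-small R-big₁ R-big₂ n-big =
      let U , sU , eU , iU = independent-subset T ⊆-refl (≤-trans (<⇒≤ R-big₁) R≤μ)
      in proj₁ (extend sU eU iU (filterᵇ-⊆ (rich m U) M) (All.map (rich-true {U = U}) (all-filterᵇ (rich m U) M))
           (≤-trans R-big₂ (R≤S U eU iU)))
      where
      R≤μ : R ≤ ∥ M ∥
      R≤μ = *-cancelʳ-≤ _ _ 100 (certify (R ∷ n ∷ ∥ L ∥ ∷ ∥ M ∥ ∷ [])
        (λ r n l μ → (r · 20000 ⊑ n) ⟨ # 1 ⟩⇒ (l · 100 ⊑ n) ⟨ # 1 ⟩⇒ (n ⊑ l ⊕ μ) ⟨ # 100 ⟩⇒ goal (r · 100 ⊑ μ · 100))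
        n-big λ-small n≤λ+μ)
      T≢0 : NonZero T
      T≢0 = >-nonZero (certify (m ∷ T ∷ []) (λ m T → ((m · 4 ⊕ # 20) · 1000 ⊑ T) ⟨ # 1 ⟩⇒ goal (# 1 ⊑ T)) T-big)
      R≤S : ∀ U → ∥ U ∥ ≡ T → Indep U → R ≤ ∥ filterᵇ (rich m U) M ∥
      -- By `row` not much more than half of all vertices can fail to be rich; `L` has at most
      -- n/100, so 0.4 n rich vertices remain in `M`.
      R≤S U eU iU = *-cancelʳ-≤ _ _ 100 (certify (R ∷ n ∷ ∥ filterᵇ (rich m U) M ∥ ∷ [])
        (λ r n s → (n · 40 ⊑ s · 100) ⟨ # 1 ⟩⇒ (r · 20000 ⊑ n) ⟨ # 40 ⟩⇒ goal (r · 100 ⊑ s · 100))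
        (*-cancelˡ-≤ T {{T≢0}} (*-cancelˡ-≤ T {{T≢0}} (certify
          (n ∷ ∥ L ∥ ∷ ∥ M ∥ ∷ T ∷ m ∷ ∑ V (sq U) ∷ ∑ M (sq U) ∷ ∑ M (ind ∘ rich m U) ∷ ∥ filterᵇ (rich m U) M ∥ ∷ [])
          (λ n l μ T m X XM s s′ →
            (μ ⊗ (T ⊗ T) ⊑ XM · 1 ⊕ μ ⊗ (T ⊗ m · 2) ⊕ s ⊗ (T ⊗ T)) ⟨ # 100 ⟩⇒ (s ⊑ s′) ⟨ T ⊗ T · 100 ⟩⇒ (XM ⊑ X) ⟨ # 100 ⟩⇒
            (X · 2 ⊑ T ⊗ n · 2 ⊕ T ⊗ T ⊗ n) ⟨ # 50 ⟩⇒ (l · 100 ⊑ n) ⟨ T ⊗ T ⟩⇒ (n ⊑ l ⊕ μ) ⟨ T ⊗ T · 100 ⟩⇒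
            (μ ⊑ n) ⟨ T ⊗ m · 200 ⟩⇒ ((m · 4 ⊕ # 20) · 1000 ⊑ T) ⟨ T ⊗ n ⟩⇒
            goal (T ⊗ (T ⊗ (n · 40)) ⊑ T ⊗ (T ⊗ (s′ · 100))))
          (rich-sum M U m eU) (≤-reflexive (∑-ind (rich m U) M)) (∑-M≤V (sq U)) (row iU eU) λ-small n≤λ+μ ∥M∥≤n T-big)))
        n-big)

    -- The constants are variables tied by inequalities, hence atoms for `certify`. Here k is the
    -- size of the sets in a forbidden triple, m that of a pair, j = m / J the tolerance for the
    -- sides, 1/Θ the density that `L` must stay below, and T₀ and T₂ are the sizes of the first
    -- independent set and of a set of bad vertices.
    impossible-for-large-n : ∀ (q : ℕ) → n ≡ q * 2 + 3 → (∀ {u v} → u ≢ v → adj G u v ≡ false → conon u v ≤ q + 1) →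
      ∀ {k J j m T₀ T₂ Θ R} → K * 6 < k → k * 2 + 1 ≡ J → J * j ≡ m → J * J * 50000 ≡ Θ →
      J * (k + 1) * 100000 ≤ j → Θ * (k + 1) * 500 < j → (m * 4 + 20) * 1000 ≤ T₀ → (k + 1) * 20000 ≤ T₂ →
      ram m₀ T₀ < R → 2 ^ T₀ * suc (ram m₀ m) ≤ R →
      100 ≤ n → R * 20000 ≤ n → Θ * (2 ^ m * (2 ^ m * suc (ram m₀ k))) * 250 ≤ n →
      2 ^ T₂ * suc (ram m₀ k) * 10000 ≤ n → ram m₀ T₂ * 1000 ≤ n →
      (2 ^ (m₀ * 4) * m₀ * 4 + m₀ * 12 + 360000) * Θ ≤ n → ⊥
    impossible-for-large-n q n≡ conon≤q+1 {k} {J} {j} {m} {T₀} {T₂} {Θ} {R} 6K<k J≡ m≡ Θ≡ j-big₁ j-big₂ T₀-big T₂-big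
      R-big₁ R-big₂ 100≤n n-big₁ n-big₂ n-big₃ n-big₄ n-big₅ =
      finish (pair-exists T₀-big (certify (n ∷ ∥ L ∥ ∷ []) (λ n l → (l · 50000 ⊑ n) ⟨ # 1 ⟩⇒ goal (l · 100 ⊑ n)) λ-small₁)
        R-big₁ R-big₂ n-big₁)
      where
      c : ℕ
      c = 2 ^ m * (2 ^ m * suc (ram m₀ k))
      1≤J : 1 ≤ J
      1≤J = ≤-trans (m≤n+m 1 (k * 2)) (≤-reflexive J≡)
      k+1≤j : (k + 1) * 100000 ≤ j
      k+1≤j = certify (k ∷ J ∷ j ∷ []) (λ k J j → (J ⊗ (k ⊕ # 1) · 100000 ⊑ j) ⟨ # 1 ⟩⇒ (# 1 ⊑ J) ⟨ (k ⊕ # 1) · 100000 ⟩⇒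
        goal ((k ⊕ # 1) · 100000 ⊑ j)) j-big₁ 1≤J
      j≤m : j ≤ m
      j≤m = certify (J ∷ j ∷ m ∷ []) (λ J j m → (J ⊗ j ⊑ m) ⟨ # 1 ⟩⇒ (# 1 ⊑ J) ⟨ j ⟩⇒ goal (j ⊑ m)) (≤-reflexive m≡) 1≤J
      kj≤m : k * j * 2 + k ≤ m
      kj≤m = certify (k ∷ J ∷ j ∷ m ∷ []) (λ k J j m → (J ⊗ j ⊑ m) ⟨ # 1 ⟩⇒ (k · 2 ⊕ # 1 ⊑ J) ⟨ j ⟩⇒ ((k ⊕ # 1) · 100000 ⊑ j) ⟨ # 1 ⟩⇒
        goal (k ⊗ j · 2 ⊕ k ⊑ m)) (≤-reflexive m≡) (≤-reflexive J≡) k+1≤j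
      j+k<m : j + k < m
      j+k<m = certify (K ∷ k ∷ J ∷ j ∷ m ∷ []) (λ K k J j m → (J ⊗ j ⊑ m) ⟨ # 1 ⟩⇒ (k · 2 ⊕ # 1 ⊑ J) ⟨ j ⟩⇒
        (# 1 ⊕ K · 6 ⊑ k) ⟨ j · 2 ⟩⇒ ((k ⊕ # 1) · 100000 ⊑ j) ⟨ # 1 ⟩⇒ goal (# 1 ⊕ (j ⊕ k) ⊑ m))
        (≤-reflexive m≡) (≤-reflexive J≡) 6K<k k+1≤j
      1≤j : 1 ≤ j
      1≤j = ≤-trans (s≤s z≤n) j-big₂
      m-big : (k * 2 + 1) * 50000 ≤ m
      m-big = certify (k ∷ j ∷ m ∷ []) (λ k j m → ((k ⊕ # 1) · 100000 ⊑ j) ⟨ # 1 ⟩⇒ (j ⊑ m) ⟨ # 1 ⟩⇒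
        goal ((k · 2 ⊕ # 1) · 50000 ⊑ m)) k+1≤j j≤m
      Θ≢0 : NonZero Θ
      Θ≢0 = >-nonZero (certify (J ∷ Θ ∷ []) (λ J Θ → (J ⊗ J · 50000 ⊑ Θ) ⟨ # 1 ⟩⇒ (# 1 ⊑ J) ⟨ J ⟩⇒ (# 1 ⊑ J) ⟨ # 1 ⟩⇒ goal (# 1 ⊑ Θ))
        (≤-reflexive Θ≡) 1≤J 1≤J)

      few-low : ∥ L ∥ * Θ < n
      -- A density of `L` of at least 1/Θ would, after division of `n-big₅` by Θ, make `L` large
      -- enough for `low-internal-degrees`, and then `low-small` refutes it.
      few-low = ≰⇒> (λ n≤ → let big = *-cancelʳ-≤ _ _ Θ {{Θ≢0}} (≤-trans n-big₅ n≤) in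
        low-small {k} {m} {T₀} {Θ} {R} 6K<k (≤-trans j-big₂ j≤m) T₀-big n-big₂ R-big₁ R-big₂ n-big₁
          (≤-trans (m≤n+m _ _) big)
          (low-internal-degrees (≤-trans (≤-trans (m≤m+n _ _) (m≤m+n _ _)) big) (≤-trans (≤-trans (m≤n+m _ (2 ^ (m₀ * 4) * m₀ * 4)) (m≤m+n _ 360000)) big)) n≤)
      λ-small₂ : ∥ L ∥ * (J * J) * 50000 ≤ n
      λ-small₂ = certify (n ∷ ∥ L ∥ ∷ J ∷ Θ ∷ []) (λ n l J Θ → (# 1 ⊕ l ⊗ Θ ⊑ n) ⟨ # 1 ⟩⇒ (J ⊗ J · 50000 ⊑ Θ) ⟨ l ⟩⇒
        goal (l ⊗ (J ⊗ J) · 50000 ⊑ n)) few-low (≤-reflexive Θ≡)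
      λ-small₁ : ∥ L ∥ * 50000 ≤ n
      λ-small₁ = certify (n ∷ ∥ L ∥ ∷ J ∷ []) (λ n l J → (l ⊗ (J ⊗ J) · 50000 ⊑ n) ⟨ # 1 ⟩⇒ (# 1 ⊑ J) ⟨ l ⊗ J · 50000 ⟩⇒
        (# 1 ⊑ J) ⟨ l · 50000 ⟩⇒ goal (l · 50000 ⊑ n)) λ-small₂ 1≤J 1≤J
      c-small : c * (J * J) * 100000 ≤ n
      c-small = certify (n ∷ c ∷ J ∷ Θ ∷ []) (λ n c J Θ → (Θ ⊗ c · 250 ⊑ n) ⟨ # 1 ⟩⇒ (J ⊗ J · 50000 ⊑ Θ) ⟨ c · 250 ⟩⇒
        goal (c ⊗ (J ⊗ J) · 100000 ⊑ n)) n-big₂ (≤-reflexive Θ≡)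

      finish : Pair m → ⊥
      finish 𝒫 = no-dense-pair (⊆-trans (sub 𝒫) M⊆V) (⊆-trans (sub (swap 𝒫)) M⊆V) (kept-large 𝒫) (kept-large (swap 𝒫)) (dense 𝒫) (dense (swap 𝒫))
        where
        open Exact q n≡ conon≤q+1 100≤n
        large : ∀ 𝒫 → n * 4999 ≤ ∥ side j k 𝒫 ∥ * 10000
        large 𝒫 = other-side-large j k (swap 𝒫) J 1≤j j≤m (≤-reflexive (sym m≡)) j-big₁ m-big λ-small₁ λ-small₂
          (few-shared (swap 𝒫) 6K<k) c-small
        -- Deleting the bad vertices, fewer than n/1000, keeps 0.49 n on each side and makes the
        -- sides dense to each other.
        kept : Pair m → List (Fin n)
        kept 𝒫 = filterᵇ (not ∘ bad j k 6K<k kj≤m 𝒫) (side j k 𝒫)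
        sub : ∀ 𝒫 → kept 𝒫 ⊆ M
        sub 𝒫 = ⊆-trans (filterᵇ-⊆ _ (side j k 𝒫)) (filterᵇ-⊆ _ M)
        kept-large : ∀ 𝒫 → n * 49 ≤ ∥ kept 𝒫 ∥ * 100
        kept-large 𝒫 = *-cancelʳ-≤ _ _ 100 (certify
          (n ∷ ram m₀ T₂ ∷ ∥ side j k 𝒫 ∥ ∷ ∥ filterᵇ (bad j k 6K<k kj≤m 𝒫) (side j k 𝒫) ∥ ∷ ∥ kept 𝒫 ∥ ∷ [])
          (λ n r a b a′ → (n · 4999 ⊑ a · 10000) ⟨ # 1 ⟩⇒ (a ⊑ b ⊕ a′) ⟨ # 10000 ⟩⇒ (# 1 ⊕ b ⊑ r) ⟨ # 10000 ⟩⇒ (r · 1000 ⊑ n) ⟨ # 10 ⟩⇒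
            goal (n · 49 · 100 ⊑ a′ · 100 · 100))
          (large 𝒫) (≤-reflexive (sym (∑-split (bad j k 6K<k kj≤m 𝒫) (side j k 𝒫) (λ _ → 1))))
          (few-bad j k 6K<k kj≤m 𝒫 j+k<m T₂-big n-big₃ (large 𝒫)) n-big₄)
        dense : ∀ 𝒫 → Dense (kept 𝒫) (kept (swap 𝒫))
        dense 𝒫 = All.map (λ {a} e → ≤-trans (*-monoˡ-≤ 50 (∑-⊆ (β a) (filterᵇ-⊆ _ (side j k (swap 𝒫))))) (≤-trans (n≤1+n _) (<ᵇ-false e)))
          (all-filterᵇ-not (bad j k 6K<k kj≤m 𝒫) (side j k 𝒫))

  -- Books

  enumerate : ∀ {A : Set} m (xs : List A) → AllPairs _≢_ xs → m ≤ ∥ xs ∥ →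
    Σ (Fin m → A) λ f → Injective _≡_ _≡_ f × (∀ i → f i ∈ xs)
  enumerate zero    xs _ _ = (λ ()) , (λ { {()} }) , λ ()
  enumerate {A} (suc m) (x ∷ xs) (x∉ ∷ u) (s≤s h) with enumerate m xs u h
  ... | f , inj , f∈ = g , g-injective , g∈
    where
    g : Fin (suc m) → A
    g zero    = x
    g (suc i) = f i
    g-injective : Injective _≡_ _≡_ g
    g-injective {zero}  {zero}  _ = refl
    g-injective {zero}  {suc j} e = contradiction e (All.lookup x∉ (f∈ j))
    g-injective {suc i} {zero}  e = contradiction (sym e) (All.lookup x∉ (f∈ i))
    g-injective {suc i} {suc j} e = cong suc (inj e)
    g∈ : ∀ i → g i ∈ x ∷ xs
    g∈ zero    = here refl
    g∈ (suc i) = there (f∈ i)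

  module Books {n : ℕ} (G : Graph n) where
    open Counting G

    book : ∀ (R : Fin n → Fin n → Set) (P : Fin n → Bool) {u v} m → u ≢ v → R u v →
      (∀ {w} → P w ≡ true → ¬ (w ≡ u) × ¬ (w ≡ v) × R u w × R v w) → m ≤ ∥ filterᵇ P V ∥ → ContainsBookIn R m
    book R P m u≢v Ruv page h with enumerate m (filterᵇ P V) (⊆V⇒distinct (filterᵇ-⊆ P V)) h
    ... | f , inj , f∈ = _ , _ , f , u≢v , Ruv , inj , λ i → page (All.lookup (all-filterᵇ P V) (f∈ i))

    adj⇒≢ : ∀ {u v} → adj G u v ≡ true → u ≢ v
    adj⇒≢ {u} e refl = contradiction (trans (sym e) (irrefl G u)) λ ()

    ind-∧ : ∀ a b → ind a * ind b ≡ ind (a ∧ b)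
    ind-∧ true  true  = refl
    ind-∧ true  false = refl
    ind-∧ false b     = refl

    adj-book : ∀ {u v} m → adj G u v ≡ true → m ≤ codeg u v → ContainsBookIn (Adj G) m
    adj-book {u} {v} m e h = book (Adj G) (λ w → adj G u w ∧ adj G v w) m (adj⇒≢ e) e
      (λ {w} t → let a , b = ∧-true {adj G u w} t in (λ eq → adj⇒≢ a (sym eq)) , (λ eq → adj⇒≢ b (sym eq)) , a , b)
      (≤-trans h (≤-reflexive (trans (∑-cong V (λ w → ind-∧ (adj G u w) (adj G v w))) (∑-ind _ V))))

    copage : Fin n → Fin n → Fin n → Bool
    copage u v w = (not (adj G u w) ∧ not ⌊ u ≟ w ⌋) ∧ (not (adj G v w) ∧ not ⌊ v ≟ w ⌋)

    coadj-book : ∀ {u v} m → u ≢ v → adj G u v ≡ false → m ≤ ∥ filterᵇ (copage u v) V ∥ → ContainsBookIn (CoAdj G) m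
    coadj-book {u} {v} m u≢v e = book (CoAdj G) (copage u v) m u≢v (u≢v , e) page
      where
      page : ∀ {w} → copage u v w ≡ true → ¬ (w ≡ u) × ¬ (w ≡ v) × CoAdj G u w × CoAdj G v w
      page {w} t with adj G u w | u ≟ w | adj G v w | v ≟ w
      ... | false | no u≢w | false | no v≢w = u≢w ∘ sym , v≢w ∘ sym , (u≢w , refl) , (v≢w , refl)

    -- The two extra units stand for u and v, which `conon` may count and a book does not.
    conon≤copages : ∀ u v → conon u v ≤ ∥ filterᵇ (copage u v) V ∥ + 1 + 1
    conon≤copages u v = ≤-trans (∑-mono (All.universal pointwise V)) (≤-trans
      (≤-reflexive (trans (∑-+ V (λ w → ind (copage u v w) + ind ⌊ u ≟ w ⌋) _)
        (cong (_+ ∑ V (λ w → ind ⌊ v ≟ w ⌋)) (∑-+ V (ind ∘ copage u v) (λ w → ind ⌊ u ≟ w ⌋)))))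
      (+-mono-≤ (+-mono-≤ (≤-reflexive (∑-ind (copage u v) V)) (∑-eq≤1 u (⊆V⇒distinct ⊆-refl))) (∑-eq≤1 v (⊆V⇒distinct ⊆-refl))))
      where
      pointwise : ∀ w → β u w * β v w ≤ ind (copage u v w) + ind ⌊ u ≟ w ⌋ + ind ⌊ v ≟ w ⌋
      pointwise w with adj G u w | u ≟ w | adj G v w | v ≟ w
      ... | true  | _     | _     | _     = z≤n
      ... | false | _     | true  | _     = z≤n
      ... | false | yes _ | false | _     = s≤s z≤n
      ... | false | no _  | false | yes _ = s≤s z≤n
      ... | false | no _  | false | no _  = s≤s z≤n

  -- The upper bound on the Ramsey number.

  upper-bound : ∀ m₀ → 2000 ≤ m₀ → ∀ K → Σ ℕ λ q₀ → ∀ {n} q p → q₀ ≤ q → n ≡ q * 2 + 3 →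
    p * 12 * K + n ≤ n * K → p * 12 ≤ n → RamseyProperty p q n
  upper-bound m₀ 2000≤m₀ K = q₀ , prove
    where
    k J Θ j m T₀ T₂ R c₁ c₂ c₃ c₄ c₅ q₀ : ℕ
    -- `k` just exceeds the 6K of `no-triple`. With `J = 2k + 1`, `m = 2kj + j` has room for the
    -- `2kj + k` of `common-neighbours`. `j`, `R` and `q₀` are sums so that each of their lower
    -- bounds is met by a summand.
    k  = K * 6 + 1
    J  = k * 2 + 1
    Θ  = J * J * 50000
    j  = J * (k + 1) * 100000 + suc (Θ * (k + 1) * 500)
    m  = J * j
    T₀ = (m * 4 + 20) * 1000
    T₂ = (k + 1) * 20000
    R  = 2 ^ T₀ * suc (ram m₀ m) + suc (ram m₀ T₀)
    c₁ = R * 20000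
    c₂ = Θ * (2 ^ m * (2 ^ m * suc (ram m₀ k))) * 250
    c₃ = 2 ^ T₂ * suc (ram m₀ k) * 10000
    c₄ = ram m₀ T₂ * 1000
    c₅ = (2 ^ (m₀ * 4) * m₀ * 4 + m₀ * 12 + 360000) * Θ
    q₀ = c₁ + (c₂ + (c₃ + (c₄ + (c₅ + 100))))

    prove : ∀ {n} q p → q₀ ≤ q → n ≡ q * 2 + 3 → p * 12 * K + n ≤ n * K → p * 12 ≤ n → RamseyProperty p q n
    prove {n} q p q₀≤q n≡ p-small 12p≤n G
      with any? (λ u → any? (λ v → (adj G u v Bool.≟ true) ×-dec (p ≤? Counting.codeg G u v)))
    ... | yes (u , v , e , h) = inj₁ (Books.adj-book G p e h)
    ... | no no-book
      with any? (λ u → any? (λ v → ¬? (u ≟ v) ×-dec (adj G u v Bool.≟ false) ×-dec (q ≤? ∥ filterᵇ (Books.copage G u v) (allFin n) ∥)))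
    ...   | yes (u , v , u≢v , e , h) = inj₂ (Books.coadj-book G q u≢v e h)
    ...   | no no-cobook = ⊥-elim (impossible-for-large-n q n≡ (λ {u} {v} → conon≤ {u} {v}) {k} {J} {j} {m} {T₀} {T₂} {Θ} {R}
            (≤-reflexive (+-comm 1 (K * 6))) refl refl refl (m≤m+n _ _) (m≤n+m _ _) ≤-refl ≤-refl
            (m≤n+m _ _) (m≤m+n _ _) (≤-trans (m≤n+m 100 _) r₄) (≤-trans (m≤m+n c₁ _) q₀≤n) (≤-trans (m≤m+n c₂ _) r₁)
            (≤-trans (m≤m+n c₃ _) r₂) (≤-trans (m≤m+n c₄ _) r₃) (≤-trans (m≤m+n c₅ _) r₄))
      where
      q₀≤n : q₀ ≤ n
      q₀≤n = ≤-trans q₀≤q (≤-trans (≤-trans (m≤m*n q 2) (m≤m+n _ 3)) (≤-reflexive (sym n≡)))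
      r₁ : c₂ + (c₃ + (c₄ + (c₅ + 100))) ≤ n
      r₁ = ≤-trans (m≤n+m _ c₁) q₀≤n
      r₂ : c₃ + (c₄ + (c₅ + 100)) ≤ n
      r₂ = ≤-trans (m≤n+m _ c₂) r₁
      r₃ : c₄ + (c₅ + 100) ≤ n
      r₃ = ≤-trans (m≤n+m _ c₃) r₂
      r₄ : c₅ + 100 ≤ n
      r₄ = ≤-trans (m≤n+m _ c₄) r₃
      codeg≤ : ∀ {u v} → adj G u v ≡ true → Counting.codeg G u v ≤ p
      codeg≤ {u} {v} e = <⇒≤ (≰⇒> (λ h → no-book (u , v , e , h)))
      conon≤ : ∀ {u v} → u ≢ v → adj G u v ≡ false → Counting.conon G u v ≤ q + 1
      conon≤ {u} {v} u≢v e = ≤-trans (Books.conon≤copages G u v) (certify (∥ filterᵇ (Books.copage G u v) (allFin n) ∥ ∷ q ∷ [])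
        (λ c q → (# 1 ⊕ c ⊑ q) ⟨ # 1 ⟩⇒ goal (c ⊕ # 1 ⊕ # 1 ⊑ q ⊕ # 1)) (≰⇒> (λ h → no-cobook (u , v , u≢v , e , h))))
      2conon≤n : ∀ {u v} → u ≢ v → adj G u v ≡ false → Counting.conon G u v * 2 ≤ n
      2conon≤n {u} {v} u≢v e = certify (Counting.conon G u v ∷ q ∷ n ∷ []) (λ c q n → (c ⊑ q ⊕ # 1) ⟨ # 2 ⟩⇒ (q · 2 ⊕ # 3 ⊑ n) ⟨ # 1 ⟩⇒
        goal (c · 2 ⊑ n)) (conon≤ u≢v e) (≤-reflexive (sym n≡))
      1≤n : 1 ≤ n
      1≤n = ≤-trans (m≤n+m 1 (q * 2 + 2)) (≤-reflexive (trans (+-assoc (q * 2) 2 1) (sym n≡)))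
      open Bounded G p K m₀ 1≤n 2000≤m₀ p-small 12p≤n codeg≤ 2conon≤n using (impossible-for-large-n)

  -- The complete bipartite graph

  module _ (q N : ℕ) where

    left : Fin N → Bool
    left x = toℕ x <ᵇ suc q

    bipartite : Graph N
    bipartite = record
      { adj    = λ x y → left x xor left y
      ; sym    = λ x y → xor-comm (left x) (left y)
      ; irrefl = λ x → xor-same (left x)
      }

    no-triangle : ∀ a b c → a xor b ≡ true → a xor c ≡ true → b xor c ≡ true → ⊥
    no-triangle true  false true  _ () _
    no-triangle true  false false _ _ ()
    no-triangle false true  true  _ _ ()
    no-triangle false true  false _ () _

    same-side : ∀ {a b} → a xor b ≡ false → b ≡ a
    same-side {true}  {true}  _ = refl
    same-side {false} {false} _ = refl

    position : Bool → Fin N → ℕ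
    position true  x = toℕ x
    position false x = toℕ x ∸ suc q

    position< : N < q * 2 + 3 → ∀ s x → left x ≡ s → position s x < suc q
    position< h true  x e = <ᵇ-true e
    position< h false x e = +-cancelʳ-≤ (suc q) _ _ (certify (position false x ∷ toℕ x ∷ q ∷ N ∷ [])
      (λ d x q N → (d ⊕ (# 1 ⊕ q) ⊑ x) ⟨ # 1 ⟩⇒ (# 1 ⊕ x ⊑ N) ⟨ # 1 ⟩⇒ (# 1 ⊕ N ⊑ q · 2 ⊕ # 3) ⟨ # 1 ⟩⇒
        goal (# 1 ⊕ d ⊕ (# 1 ⊕ q) ⊑ # 1 ⊕ q ⊕ (# 1 ⊕ q)))
      (≤-reflexive (m∸n+n≡m (<ᵇ-false {n = suc q} e))) (toℕ<n x) h)

    position-injective : ∀ s {x y} → left x ≡ s → left y ≡ s → position s x ≡ position s y → x ≡ y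
    position-injective true  ex ey e = toℕ-injective e
    position-injective false ex ey e = toℕ-injective (∸-cancelʳ-≡ (<ᵇ-false {n = suc q} ex) (<ᵇ-false {n = suc q} ey) e)

    -- Pigeonhole: `position` numbers each side below q + 1, the right one because N ≤ 2q + 2.
    few-on-side : N < q * 2 + 3 → ∀ s {l} (f : Fin l → Fin N) → (∀ i → left (f i) ≡ s) → Injective _≡_ _≡_ f → l ≤ suc q
    few-on-side h s f on inj = injective⇒≤ {f = λ i → fromℕ< (position< h s (f i) (on i))}
      (λ {i} {j} e → inj (position-injective s (on i) (on j) (fromℕ<-injective _ _ (position< h s (f i) (on i)) (position< h s (f j) (on j)) e)))

    -- A page of a book in the bipartite graph closes a triangle; a complement book with q pages
    -- puts q + 2 vertices on one side.
    not-ramsey : ∀ p → 1 ≤ p → N < q * 2 + 3 → ¬ RamseyProperty p q N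
    not-ramsey (suc p) _ h ramsey with ramsey bipartite
    ... | inj₁ (u , v , f , _ , uv , _ , page) with page zero
    ...   | _ , _ , uw , vw = no-triangle (left u) (left v) (left (f zero)) uv uw vw
    not-ramsey (suc p) _ h ramsey | inj₂ (u , v , f , u≢v , (_ , uv) , inj , page) =
      <⇒≱ (n<1+n (suc q)) (few-on-side h (left u) g on g-injective)
      where
      g : Fin (suc (suc q)) → Fin N
      g zero          = u
      g (suc zero)    = v
      g (suc (suc i)) = f i
      on : ∀ i → left (g i) ≡ left u
      on zero          = refl
      on (suc zero)    = same-side uv
      on (suc (suc i)) = same-side (proj₂ (proj₁ (proj₂ (proj₂ (page i)))))
      g-injective : Injective _≡_ _≡_ g
      g-injective {zero}        {zero}        e = refl
      g-injective {zero}        {suc zero}    e = contradiction e u≢v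
      g-injective {zero}        {suc (suc j)} e = contradiction (sym e) (proj₁ (page j))
      g-injective {suc zero}    {zero}        e = contradiction (sym e) u≢v
      g-injective {suc zero}    {suc zero}    e = refl
      g-injective {suc zero}    {suc (suc j)} e = contradiction (sym e) (proj₁ (proj₂ (page j)))
      g-injective {suc (suc i)} {zero}        e = contradiction e (proj₁ (page i))
      g-injective {suc (suc i)} {suc zero}    e = contradiction e (proj₁ (proj₂ (page i)))
      g-injective {suc (suc i)} {suc (suc j)} e = cong (λ i → suc (suc i)) (inj e)

-- From rational to natural-number inequalities.

module Fractions where

  open import Data.Integer as ℤ using (+_)
  import Data.Integer.Properties as ℤ
  open import Data.Integer.Tactic.RingSolver using (solve-∀)
  open import Data.Nat using (suc; _+_; _*_; _≤_)
  open import Data.Rational as ℚ using (_/_; toℚᵘ)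
  import Data.Rational.Properties as ℚ
  open import Data.Rational.Unnormalised as ℚᵘ using (mkℚᵘ)
  import Data.Rational.Unnormalised.Properties as ℚᵘ
  open import Relation.Binary.PropositionalEquality using (_≡_; sym; trans; cong; cong₂; subst₂)

  -- Normalised arithmetic divides by greatest common divisors; unnormalised fractions keep
  -- numerator and denominator explicit.
  unnormalise : ∀ {ε p q} → (+ p / 1) ℚ.≤ (+ 1 / 6 ℚ.- ε) ℚ.* (+ q / 1) →
    mkℚᵘ (+ p) 0 ℚᵘ.≤ (mkℚᵘ (+ 1) 5 ℚᵘ.- toℚᵘ ε) ℚᵘ.* mkℚᵘ (+ q) 0
  unnormalise {ε} {p} {q} h = ℚᵘ.≤-respˡ-≃ (ℚ.toℚᵘ-fromℚᵘ (mkℚᵘ (+ p) 0)) (ℚᵘ.≤-respʳ-≃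
    (ℚᵘ.≃-trans (ℚ.toℚᵘ-homo-* (+ 1 / 6 ℚ.- ε) (+ q / 1))
      (ℚᵘ.*-cong (ℚᵘ.≃-trans (ℚ.toℚᵘ-homo-+ (+ 1 / 6) (ℚ.- ε)) (ℚᵘ.+-congʳ (mkℚᵘ (+ 1) 5) (ℚ.toℚᵘ-homo‿- ε)))
        (ℚ.toℚᵘ-fromℚᵘ (mkℚᵘ (+ q) 0))))
    (ℚ.toℚᵘ-mono-≤ h))

  -- `mkℚᵘ (+ a) d` is a/(d + 1). After cross-multiplication the negative term -6aq moves to the
  -- left, so that only natural numbers remain.
  clear-denominators : ∀ a d p q → mkℚᵘ (+ p) 0 ℚᵘ.≤ (mkℚᵘ (+ 1) 5 ℚᵘ.- mkℚᵘ (+ a) d) ℚᵘ.* mkℚᵘ (+ q) 0 →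
    p * (6 * suc d * 1) + a * q * 6 ≤ suc d * q
  clear-denominators a d p q (ℚᵘ.*≤* h) = ℤ.drop‿+≤+ (subst₂ ℤ._≤_
    (trans (cong₂ ℤ._+_ (sym (ℤ.pos-* p (6 * suc d * 1))) (trans (cong (ℤ._* + 6) (sym (ℤ.pos-* a q))) (sym (ℤ.pos-* (a * q) 6))))
      (sym (ℤ.pos-+ (p * (6 * suc d * 1)) (a * q * 6))))
    (trans (eq (+ a) (+ suc d) (+ q)) (sym (ℤ.pos-* (suc d) q)))
    (ℤ.+-monoˡ-≤ (+ a ℤ.* + q ℤ.* + 6) h))
    where
    eq : ∀ a d q → (+ 1 ℤ.* d ℤ.+ (ℤ.- a) ℤ.* + 6) ℤ.* q ℤ.* + 1 ℤ.+ a ℤ.* q ℤ.* + 6 ≡ d ℤ.* q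
    eq = solve-∀

open import Data.Nat using (ℕ; _≤_; _+_; _*_)
open import Data.Product using (Σ; _×_)
open import Data.Integer using (+_)
open import Data.Rational as ℚ using (ℚ; 0ℚ; 1ℚ; _<_; _-_; _/_)
open import Data.Rational using () renaming (_≤_ to _≤ℚ_; _*_ to _*ℚ_)
open import Data.Integer using (+<+)
open import Data.Nat using (zero; suc)
open import Data.Nat.Properties using (≤-refl; ≤-trans; m≤m+n; *-cancelʳ-≤; *-comm)
open import Data.Product using (_,_)
open import Data.Rational using (mkℚ; *<*)
open import Data.Vec using ([]; _∷_)
open import Relation.Binary.PropositionalEquality using (_≡_; cong; sym; subst)
open BookRamsey
open Fractions

theorem4 : (ε : ℚ) → 0ℚ < ε → ε < + 1 / 6 →
    Σ ℕ λ q₀ → (q p : ℕ) → q₀ ≤ q → 1 ≤ p →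
    (+ p / 1) ≤ℚ ((+ 1 / 6 - ε) *ℚ (+ q / 1)) →
    BookRamseyEq p q (2 * q + 3)
theorem4 (mkℚ (+ zero) _ _) (*<* (+<+ ())) _
theorem4 ε@(mkℚ (+ suc a) d _) _ _ =
  -- K is the denominator of ε: the numerator is positive, so ε ≥ 1/K, which provides the slack p ≤
  -- n/12 - n/(12K).
  let q₀ , upper = upper-bound 2000 ≤-refl (suc d)
  in q₀ , λ q p q₀≤q 1≤p h →
    let n≡ : 2 * q + 3 ≡ q * 2 + 3
        n≡ = cong (_+ 3) (*-comm 2 q)
        p-small : p * 12 * suc d + (2 * q + 3) ≤ (2 * q + 3) * suc d
        p-small = subst (λ n → p * 12 * suc d + n ≤ n * suc d) (sym n≡) (certify (a ∷ d ∷ p ∷ q ∷ [])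
          (λ a d p q → (p ⊗ (# 6 ⊗ (# 1 ⊕ d) ⊗ # 1) ⊕ (# 1 ⊕ a) ⊗ q · 6 ⊑ (# 1 ⊕ d) ⊗ q) ⟨ # 2 ⟩⇒
            goal (p · 12 ⊗ (# 1 ⊕ d) ⊕ (q · 2 ⊕ # 3) ⊑ (q · 2 ⊕ # 3) ⊗ (# 1 ⊕ d)))
          (clear-denominators (suc a) d p q (unnormalise {ε} {p} {q} h)))
    in upper q p q₀≤q n≡ p-small (*-cancelʳ-≤ _ _ (suc d) (≤-trans (m≤m+n _ _) p-small)) ,
       λ M M<n → not-ramsey q M p 1≤p (subst (M Data.Nat.<_) n≡ M<n)
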